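{- If $k\geq l\geq 2$ are integers, then $\mathrm{ex}(n,C_{2l+1},\textnormal{rainbow- }C_{2k+1})=\Theta(n^{2l-1})$.
   Context: A proper edge-colouring of a graph assigns colours to edges so that any two edges sharing a vertex receive different colours. A subgraph of an edge-coloured graph is rainbow if all its edges have distinct colours. $\mathrm{ex}(n,H,\textnormal{rainbow- }F)$ denotes the maximum number of copies of $H$ in a properly edge-coloured graph on $n$ vertices containing no rainbow subgraph isomorphic to $F$. $C_m$ denotes the cycle of length $m$. Implied constants may depend on $k$ and $l$. -}

module Defs where

open import Data.Nat using (ℕ; zero; suc; _+_; _*_; _∸_; _^_; _≤_; _/_)
open import Data.Nat.Properties using () renaming (_≟_ to _≟ℕ_)
open import Data.Fin using (Fin; _≟_)
open import Data.Fin.Base using ()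
open import Data.List using (List; []; _∷_; [_]; _++_; map; concatMap; length; filterᵇ; zip; mapMaybe; allFin)
open import Data.Vec using (Vec; toList) renaming ([] to []ᵛ; _∷_ to _∷ᵛ_)
open import Data.Bool.ListAction using (all; any)
open import Data.Maybe using (Maybe; just; nothing; is-just)
open import Data.Bool using (Bool; true; false; _∧_; not)
open import Data.Product using (Σ; _×_; _,_; proj₁; proj₂)
open import Relation.Nullary using (¬_)
open import Relation.Nullary.Decidable using (⌊_⌋)
open import Relation.Binary.PropositionalEquality using (_≡_; _≢_)
open import Data.List.Relation.Unary.Unique.Propositional using (Unique)

-- A simple graph on vertex set Fin n together with an edge-colouring:
-- col u v = just c  means uv is an edge with colour c; nothing means non-edge.
record ColouredGraph (n : ℕ) : Set where
  field
    col    : Fin n → Fin n → Maybe ℕ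
    sym    : ∀ u v → col u v ≡ col v u
    irrefl : ∀ u → col u u ≡ nothing
open ColouredGraph public

Proper : ∀ {n} → ColouredGraph n → Set
Proper {n} G = ∀ (u v w : Fin n) (c : ℕ) → v ≢ w →
  col G u v ≡ just c → col G u w ≡ just c → ⊥'
  where open import Data.Empty renaming (⊥ to ⊥')

allVecs : (m n : ℕ) → List (Vec (Fin n) m)
allVecs zero    n = [ []ᵛ ]
allVecs (suc m) n = concatMap (λ i → map (i ∷ᵛ_) (allVecs m n)) (allFin n)

cyclePairs : ∀ {n} → List (Fin n) → List (Fin n × Fin n)
cyclePairs []       = []
cyclePairs (x ∷ xs) = zip (x ∷ xs) (xs ++ [ x ])

distinctᵇ : ∀ {n} → List (Fin n) → Bool
distinctᵇ []       = true
distinctᵇ (x ∷ xs) = not (any (λ y → ⌊ x ≟ y ⌋) xs) ∧ distinctᵇ xs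

isCycleᵇ : ∀ {n m} → ColouredGraph n → Vec (Fin n) m → Bool
isCycleᵇ G vs = distinctᵇ (toList vs) ∧
  all (λ p → is-just (col G (proj₁ p) (proj₂ p))) (cyclePairs (toList vs))

cycleColours : ∀ {n m} → ColouredGraph n → Vec (Fin n) m → List ℕ
cycleColours G vs = mapMaybe (λ p → col G (proj₁ p) (proj₂ p)) (cyclePairs (toList vs))

labelledCycles : ∀ {n} → ColouredGraph n → ℕ → ℕ
labelledCycles {n} G m = length (filterᵇ (isCycleᵇ G) (allVecs m n))

-- number of copies of C_m (m ≥ 3) in G: each copy has 2m labellings
cycleCopies : ∀ {n} → ColouredGraph n → (m : ℕ) → ℕ
cycleCopies G zero    = 0
cycleCopies G (suc m) = labelledCycles G (suc m) / (2 * suc m)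

HasRainbowCycle : ∀ {n} → ColouredGraph n → ℕ → Set
HasRainbowCycle {n} G m =
  Σ (Vec (Fin n) m) λ vs → (isCycleᵇ G vs ≡ true) × Unique (cycleColours G vs)

{-# OPTIONS --safe #-}
module Submission where

-- Upper bound.  Let l = 2 + j, so that cycles have 5 + 2j vertices and at most n^(3+2j) of
-- them are claimed, up to a constant.  If more than this many cycles of one kind existed,
-- some nonempty subfamily (a core) would resist fixing: whenever all but two prescribed
-- vertices of a member are kept, the two varied vertices still take many values inside the
-- subfamily.  There are three kinds.
--  * Rainbow cycles x₁ x₂ x₃ x₄ r, with one of x₁, x₂ and one of x₃, x₄ varied.  If in the core
--    every x₃ sees many x₄ and conversely, alternate between them.  Otherwise some x₃ sees
--    few x₄ (or conversely); fixing it forces x₁ and x₂ to see many of each other.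
--    Alternating greedily gives a rainbow cycle of the forbidden length.
--  * Cycles a v g d c h whose only repetition away from a is that the closing edge at a has
--    the colour of dc.  Keeping everything but a, v, the edge dc determines a, so v takes many
--    values; keeping everything but a, d, the vertex a determines d, so a takes many
--    values.  Hence a and v can alternate.
--  * Cycles with a further repeated colour away from a.  Each of the two repetitions
--    determines one vertex, so these can be counted directly.
-- Every cycle that is not rainbow has a rotation of the second or third kind.
--
-- Lower bound.  Blow up C_{2l+1} and join two disjoint pairs of consecutive classes by
-- matchings of a common colour.  Every odd cycle uses both pairs, so none is rainbow.

open import Defs renaming (sym to col-sym)
open import Data.Bool using (Bool; true; false; if_then_else_; not; _∧_; _∨_; T; T?)
open import Data.Bool.Properties using (∨-comm; not-¬; ¬-not; not-involutive) renaming (_≟_ to _≟B_)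
open import Data.Bool.ListAction using (all; any)
open import Data.Empty using (⊥; ⊥-elim)
open import Data.Fin using (Fin; zero; suc; toℕ) renaming (_≟_ to _≟F_)
open import Data.Fin.Properties using (toℕ-fromℕ<; toℕ-injective; toℕ<n)
open import Data.List using (List; []; _∷_; [_]; _++_; map; concatMap; length; filter; filterᵇ; reverse; mapMaybe; allFin; cartesianProduct; zip)
open import Data.List.Membership.Propositional using (_∈_; _∉_; find)
open import Data.List.Membership.Propositional.Properties using (∈-∃++; ∈-++⁺ˡ; ∈-++⁺ʳ; ∈-++⁻; ∈-insert; ∈-map⁺; ∈-map⁻; ∈-filter⁺; ∈-filter⁻; ∈-allFin; ∈-concatMap⁺; ∈-cartesianProduct⁺)
import Data.List.Membership.DecPropositional as DecMembership
open import Data.List.Properties using (length-++; length-map; ++-assoc; ++-identityʳ; length-reverse; unfold-reverse; filter-notAll; ∷-injective; ∷-injectiveˡ; ∷-injectiveʳ; ∷ʳ-injective; ≡-dec; reverse-++; length-tabulate)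
open import Data.List.Relation.Binary.Permutation.Propositional using (_↭_; ↭-sym)
open import Data.List.Relation.Binary.Permutation.Propositional.Properties using (All-resp-↭; ++-comm; ↭-reverse)
open import Data.List.Relation.Unary.All as All using (All; []; _∷_)
open import Data.List.Relation.Unary.All.Properties using (All¬⇒¬Any; ¬Any⇒All¬) renaming (map⁺ to All-map⁺; map⁻ to All-map⁻; ++⁺ to All-++⁺; ++⁻ˡ to All-++⁻ˡ; filter⁺ to All-filter⁺)
open import Data.List.Relation.Unary.AllPairs as AllPairs using ([]; _∷_)
open import Data.List.Relation.Unary.AllPairs.Properties using () renaming (map⁺ to AllPairs-map⁺; map⁻ to AllPairs-map⁻)
open import Data.List.Relation.Unary.Any as Any using (here; there; any?)
open import Data.List.Relation.Unary.Unique.Propositional using (Unique)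
import Data.List.Relation.Unary.Unique.Propositional.Properties as Unique
open import Data.Maybe using (Maybe; just; nothing; is-just)
open import Data.Maybe.Properties using (just-injective) renaming (≡-dec to Maybe-≡-dec)
open import Data.Nat using (ℕ; zero; suc; _+_; _*_; _∸_; _^_; _≤_; _<_; z≤n; s≤s; s≤s⁻¹; _/_; _%_; _≡ᵇ_; NonZero; >-nonZero; _≤?_)
open import Data.Nat.DivMod using (_mod_; m/n≤m; m<n⇒m%n≡m; m≡m%n+[m/n]*n; m%n<n; [m+kn]%n≡m%n; m*n/n≡m; m≥n⇒m/n>0; m/n*n≤m; /-monoˡ-≤)
open import Data.Nat.Properties
open import Data.Nat.Tactic.RingSolver using (solve-∀)
open import Data.Product using (Σ; ∃; _×_; _,_; proj₁; proj₂)
open import Data.Sum using (_⊎_; inj₁; inj₂)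
open import Data.Unit using (⊤; tt)
open import Data.Vec using (Vec; toList) renaming ([] to []ᵛ; _∷_ to _∷ᵛ_)
open import Data.Vec.Properties using (length-toList)
open import Function using (_∘_; id; case_of_)
open import Relation.Binary using (DecidableEquality)
open import Relation.Binary.PropositionalEquality hiding ([_])
open import Relation.Nullary using (¬_; yes; no)
open import Relation.Nullary.Decidable using (⌊_⌋; decidable-stable; ¬?)

-- Counting predicates

-- Cardinality at most `M`, phrased through repetition-free lists so that `P` can be any predicate,
-- without enumeration or decision procedure.
Bounded : {A : Set} → (A → Set) → ℕ → Set
Bounded P M = ∀ xs → Unique xs → All P xs → length xs ≤ M

bounded-∈ : {A : Set} (zs : List A) → Bounded (_∈ zs) (length zs)
bounded-∈ zs [] _ _ = z≤n
bounded-∈ zs (x ∷ xs) (x∉xs ∷ uxs) (x∈zs ∷ xs⊆zs) with as , bs , refl ← ∈-∃++ x∈zs =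
  subst (suc (length xs) ≤_) (sym (trans (length-++ as) (+-suc (length as) (length bs))))
    (s≤s (subst (length xs ≤_) (length-++ as)
      (bounded-∈ (as ++ bs) xs uxs (All.zipWith delete (x∉xs , xs⊆zs)))))
  where
  delete : ∀ {y} → x ≢ y × y ∈ as ++ x ∷ bs → y ∈ as ++ bs
  delete (x≢y , y∈) with ∈-++⁻ as y∈
  ... | inj₁ y∈as = ∈-++⁺ˡ y∈as
  ... | inj₂ (here y≡x) = ⊥-elim (x≢y (sym y≡x))
  ... | inj₂ (there y∈bs) = ∈-++⁺ʳ as y∈bs

bounded-⊥ : {A : Set} {P : A → Set} {M : ℕ} → (∀ {x} → ¬ P x) → Bounded P M
bounded-⊥ ¬P [] _ _ = z≤n
bounded-⊥ ¬P (x ∷ xs) _ (px ∷ _) = ⊥-elim (¬P px)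

bounded-≤ : {A : Set} {P : A → Set} {M N : ℕ} → M ≤ N → Bounded P M → Bounded P N
bounded-≤ M≤N bP xs uxs pxs = ≤-trans (bP xs uxs pxs) M≤N

bounded-⊎ : {A : Set} {P Q : A → Set} {M N : ℕ} →
  Bounded P M → Bounded Q N → Bounded (λ x → P x ⊎ Q x) (M + N)
bounded-⊎ {A} {P} {Q} bP bQ xs uxs pqs with partition xs uxs pqs
  where
  partition : ∀ xs → Unique xs → All (λ x → P x ⊎ Q x) xs → ∃ λ ys → ∃ λ zs →
    Unique ys × Unique zs × All P ys × All Q zs ×
    (∀ {R : A → Set} → All R xs → All R ys × All R zs) × length xs ≡ length ys + length zs
  partition [] _ _ = [] , [] , [] , [] , [] , [] , (λ _ → [] , []) , refl
  partition (x ∷ xs) (x∉ ∷ uxs) (pq ∷ pqs) with partition xs uxs pqs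
  ... | ys , zs , uys , uzs , pys , qzs , sub , eq with pq
  ... | inj₁ p = x ∷ ys , zs , proj₁ (sub x∉) ∷ uys , uzs , p ∷ pys , qzs ,
        (λ { (r ∷ rs) → r ∷ proj₁ (sub rs) , proj₂ (sub rs) }) , cong suc eq
  ... | inj₂ q = ys , x ∷ zs , uys , proj₂ (sub x∉) ∷ uzs , pys , q ∷ qzs ,
        (λ { (r ∷ rs) → proj₁ (sub rs) , r ∷ proj₂ (sub rs) }) ,
        trans (cong suc eq) (sym (+-suc (length ys) (length zs)))
... | ys , zs , uys , uzs , pys , qzs , _ , eq =
  subst (_≤ _) (sym eq) (+-mono-≤ (bP ys uys pys) (bQ zs uzs qzs))

bounded-∃ : {A : Set} {P : ℕ → A → Set} {M : ℕ} (q : ℕ) →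
  (∀ i → i < q → Bounded (P i) M) → Bounded (λ x → ∃ λ i → i < q × P i x) (q * M)
bounded-∃ zero bP = bounded-⊥ λ { (_ , () , _) }
bounded-∃ {P = P} (suc q) bP xs uxs pxs =
  bounded-⊎ (bP 0 (s≤s z≤n)) (bounded-∃ q (λ i i<q → bP (suc i) (s≤s i<q))) xs uxs
    (All.map (λ { (zero , _ , p) → inj₁ p ; (suc i , s≤s i<q , p) → inj₂ (i , i<q , p) }) pxs)

-- One partner is chosen for each element, and `R-inj` keeps the chosen partners distinct. A
-- relation in place of a function lets the partner be read off from the proof of `P x`.
bounded-rel : {A B : Set} {P : A → Set} {Q : B → Set} {M : ℕ} (R : A → B → Set) →
  (∀ {x x' y} → R x y → R x' y → x ≡ x') →
  (∀ {x} → P x → ∃ λ y → Q y × R x y) → Bounded Q M → Bounded P M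
bounded-rel {A} {B} {P} {Q} R R-inj total bQ xs uxs pxs with image xs uxs pxs
  where
  image : ∀ xs → Unique xs → All P xs → ∃ λ ys → Unique ys × All Q ys ×
    length xs ≡ length ys × (∀ {y} → y ∈ ys → ∃ λ x → x ∈ xs × R x y)
  image [] _ _ = [] , [] , [] , refl , λ ()
  image (x ∷ xs) (x∉ ∷ uxs) (p ∷ pxs) with image xs uxs pxs | total p
  ... | ys , uys , qys , eq , back | y , qy , xRy =
    y ∷ ys , All.tabulate fresh ∷ uys , qy ∷ qys , cong suc eq ,
    λ { (here refl) → x , here refl , xRy
      ; (there y∈) → let x' , x'∈ , r = back y∈ in x' , there x'∈ , r }
    where
    fresh : ∀ {z} → z ∈ ys → y ≢ z
    fresh z∈ refl with x' , x'∈ , r ← back z∈ = All.lookup x∉ x'∈ (R-inj xRy r)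
... | ys , uys , qys , eq , _ = subst (_≤ _) (sym eq) (bQ ys uys qys)

++-injective : {A : Set} (xs xs' : List A) {ys ys' : List A} → length xs ≡ length xs' →
  xs ++ ys ≡ xs' ++ ys' → xs ≡ xs' × ys ≡ ys'
++-injective [] [] _ e = refl , e
++-injective (x ∷ xs) (x' ∷ xs') len e with refl , e' ← ∷-injective e
  with refl , refl ← ++-injective xs xs' (suc-injective len) e' = refl , refl

length-cartesianProduct : {A B : Set} (xs : List A) (ys : List B) →
  length (cartesianProduct xs ys) ≡ length xs * length ys
length-cartesianProduct [] ys = refl
length-cartesianProduct (x ∷ xs) ys = trans (length-++ (map (x ,_) ys))
  (cong₂ _+_ (length-map (x ,_) ys) (length-cartesianProduct xs ys))

word : {n m : ℕ} (xs : List (Fin n)) → length xs ≡ m → ∃ λ (v : Vec (Fin n) m) → toList v ≡ xs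
word [] refl = []ᵛ , refl
word (x ∷ xs) refl = let v , eq = word xs refl in x ∷ᵛ v , cong (x ∷_) eq

bounded-words : (n m : ℕ) → Bounded (λ (xs : List (Fin n)) → length xs ≡ m) (n ^ m)
bounded-words n zero = λ xs uxs all → bounded-∈ ([] ∷ []) xs uxs (All.map (λ { {[]} _ → here refl }) all)
bounded-words n (suc m) xs uxs all =
  bounded-∃ {P = λ i xs → ∃ λ x → ∃ λ ys → toℕ x ≡ i × xs ≡ x ∷ ys × length ys ≡ m} n
    (λ i i<n → bounded-rel (λ xs ys → ∃ λ x → toℕ x ≡ i × xs ≡ x ∷ ys)
      (λ { (x , ex , refl) (x' , ex' , refl) → cong (_∷ _) (toℕ-injective (trans ex (sym ex'))) })
      (λ { (x , ys , ex , eq , l) → ys , l , x , ex , eq })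
      (bounded-words n m))
    xs uxs (All.map (λ { {x ∷ ys} l → toℕ x , toℕ<n x , x , ys , refl , refl , suc-injective l }) all)

-- If a finite set has no nonempty subset all of whose κ-fibres resist being covered
-- by D values of π, then fibres covered by D values can be deleted one at a time
-- until nothing is left, and each deletion uses up a key.
module _ {X P : Set} {n q : ℕ} (N D : ℕ) (S : X → Set)
  (κ : Fin q → X → List (Fin n)) (π : Fin q → X → P)
  (κ-length : ∀ i {x} → S x → length (κ i x) ≡ N)
  (κπ-injective : ∀ i {x y} → S x → S y → κ i x ≡ κ i y → π i x ≡ π i y → x ≡ y)
  where

  Uncoverable : List X → Set
  Uncoverable ys = ∀ i {x} → x ∈ ys → (F : List P) → length F ≤ D →
    (∀ {y} → y ∈ ys → κ i y ≡ κ i x → π i y ∈ F) → ⊥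

  bounded-coreless : (∀ ys → All S ys → Uncoverable ys → ∀ {y} → y ∈ ys → ⊥) →
    Bounded S (D * (q * n ^ N))
  bounded-coreless coreless xs uxs sxs = decidable-stable (length xs ≤? D * (q * n ^ N))
    -- Whether a family is uncoverable is never decided, so the deletions run under a double
    -- negation, which is removed because `≤` is decidable.
    (λ |xs|≰ → peel (length xs) xs ≤-refl uxs sxs
      λ (ks , uks , from , le) → |xs|≰ (≤-trans le (*-monoʳ-≤ D
        (bounded-keys ks uks (All.map key-length from)))))
    where
    Key = Fin q × List (Fin n)

    bounded-keys : Bounded (λ ((i , k) : Key) → length k ≡ N) (q * n ^ N)
    bounded-keys ks uks all = bounded-∃ {P = λ j ((i , k) : Key) → toℕ i ≡ j × length k ≡ N} q
      (λ j _ → bounded-rel (λ (i , k) k' → toℕ i ≡ j × k ≡ k')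
        (λ { (refl , refl) (e , refl) → cong (_, _) (toℕ-injective (sym e)) })
        (λ { {i , k} (e , l) → k , l , e , refl }) (bounded-words n N))
      ks uks (All.map (λ { {i , k} l → toℕ i , toℕ<n i , refl , l }) all)

    key-length : ∀ {k : Key} → (∃ λ x → (x ∈ xs × S x) × κ (proj₁ k) x ≡ proj₂ k) → length (proj₂ k) ≡ N
    key-length {i , _} (x , (_ , sx) , refl) = κ-length i sx

    -- A key pairs an index `i` with the value of `κ i` on a deleted fibre. The whole fibre goes, so
    -- its key cannot arise again from what remains, and each key accounts for at most `D` elements.
    peel : ∀ fuel ys → length ys ≤ fuel → Unique ys → All S ys →
      ¬ ¬ (∃ λ (ks : List Key) → Unique ks ×
           All (λ k → ∃ λ x → (x ∈ ys × S x) × κ (proj₁ k) x ≡ proj₂ k) ks ×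
           length ys ≤ D * length ks)
    peel _ [] _ _ _ done = done ([] , [] , [] , z≤n)
    peel (suc fuel) ys@(_ ∷ _) ys≤ uys sys done = coreless ys sys delete (here refl)
      where
      delete : Uncoverable ys
      delete i {x} x∈ F |F|≤D cover =
        peel fuel rest
          (s≤s⁻¹ (≤-trans (filter-notAll keep? ys (Any.map (λ { refl ne → ne refl }) x∈)) ys≤))
          (Unique.filter⁺ keep? uys) (All-filter⁺ keep? sys)
          λ (ks , uks , from , le) → done
            ( (i , κ i x) ∷ ks
            , All.map (λ { {_ , _} (z , (z∈ , _) , e) refl → proj₂ (∈-filter⁻ keep? {xs = ys} z∈) e }) from ∷ uks
            , (x , (x∈ , All.lookup sys x∈) , refl) ∷
              All.map (λ { (z , (z∈ , sz) , e) → z , (proj₁ (∈-filter⁻ keep? z∈) , sz) , e }) from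
            , ≤-trans split (subst (D + length rest ≤_) (sym (*-suc D (length ks))) (+-monoʳ-≤ D le)) )
        where
        keep? = λ y → ¬? (≡-dec _≟F_ (κ i y) (κ i x))
        rest = filter keep? ys

        fibre-bounded : Bounded (λ y → S y × y ∈ ys × κ i y ≡ κ i x) D
        fibre-bounded = bounded-≤ |F|≤D (bounded-rel (λ y f → S y × κ i y ≡ κ i x × π i y ≡ f)
          (λ { (sy , ey , py) (sz , ez , pz) → κπ-injective i sy sz (trans ey (sym ez)) (trans py (sym pz)) })
          (λ { (sy , y∈ , ey) → _ , cover y∈ ey , sy , ey , refl })
          (bounded-∈ F))

        split : length ys ≤ D + length rest
        split = bounded-⊎ fibre-bounded (bounded-∈ rest) ys uys (All.tabulate λ {y} y∈ →
          case ≡-dec _≟F_ (κ i y) (κ i x) of λ where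
            (yes e) → inj₁ (All.lookup sys y∈ , y∈ , e)
            (no ne) → inj₂ (∈-filter⁺ keep? y∈ ne))

-- Paths and cycles as lists of vertices

unique-resp-↭ : {A : Set} {xs ys : List A} → xs ↭ ys → Unique xs → Unique ys
unique-resp-↭ _↭_.refl u = u
unique-resp-↭ (_↭_.prep x σ) (x∉ ∷ u) = All-resp-↭ σ x∉ ∷ unique-resp-↭ σ u
unique-resp-↭ (_↭_.swap x y σ) ((x≢y ∷ x∉) ∷ y∉ ∷ u) =
  ((x≢y ∘ sym) ∷ All-resp-↭ σ y∉) ∷ All-resp-↭ σ x∉ ∷ unique-resp-↭ σ u
unique-resp-↭ (_↭_.trans σ τ) u = unique-resp-↭ τ (unique-resp-↭ σ u)

unique-++⁻ˡ : {A : Set} (xs : List A) {ys : List A} → Unique (xs ++ ys) → Unique xs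
unique-++⁻ˡ [] _ = []
unique-++⁻ˡ (x ∷ xs) (x∉ ∷ u) = All-++⁻ˡ xs x∉ ∷ unique-++⁻ˡ xs u

unique-++⁻ʳ : {A : Set} (xs : List A) {ys : List A} → Unique (xs ++ ys) → Unique ys
unique-++⁻ʳ [] u = u
unique-++⁻ʳ (x ∷ xs) (_ ∷ u) = unique-++⁻ʳ xs u

IsJust : {A : Set} → Maybe A → Set
IsJust m = ∃ λ c → m ≡ just c

last : {A : Set} → A → List A → A
last x [] = x
last x (y ∷ ys) = last y ys

last-∈ : {A : Set} (x : A) (xs : List A) → last x xs ∈ x ∷ xs
last-∈ x [] = here refl
last-∈ x (y ∷ ys) = there (last-∈ y ys)

last-++ : {A : Set} (x : A) (xs : List A) {y : A} {ys : List A} → last x (xs ++ y ∷ ys) ≡ last y ys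
last-++ x [] = refl
last-++ x (z ∷ xs) = last-++ z xs

all-true⁻ : {A : Set} (f : A → Bool) (xs : List A) → all f xs ≡ true → All (λ x → f x ≡ true) xs
all-true⁻ f [] _ = []
all-true⁻ f (x ∷ xs) e with f x in eq
... | true = eq ∷ all-true⁻ f xs e

all-true⁺ : {A : Set} (f : A → Bool) {xs : List A} → All (λ x → f x ≡ true) xs → all f xs ≡ true
all-true⁺ f [] = refl
all-true⁺ f (e ∷ es) rewrite e = all-true⁺ f es

∧-true⁻ : ∀ a {b} → a ∧ b ≡ true → a ≡ true × b ≡ true
∧-true⁻ true e = refl , e

is-just⁻ : {A : Set} (m : Maybe A) → is-just m ≡ true → IsJust m
is-just⁻ (just c) _ = c , refl

notAny⁻ : ∀ {n} (x : Fin n) xs → not (any (λ y → ⌊ x ≟F y ⌋) xs) ≡ true → All (x ≢_) xs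
notAny⁻ x [] _ = []
notAny⁻ x (y ∷ ys) e with x ≟F y
... | no ne = ne ∷ notAny⁻ x ys e

notAny⁺ : ∀ {n} {x : Fin n} {xs} → All (x ≢_) xs → not (any (λ y → ⌊ x ≟F y ⌋) xs) ≡ true
notAny⁺ [] = refl
notAny⁺ {x = x} {y ∷ ys} (ne ∷ nes) with x ≟F y
... | yes e = ⊥-elim (ne e)
... | no _ = notAny⁺ nes

distinct⁻ : ∀ {n} (xs : List (Fin n)) → distinctᵇ xs ≡ true → Unique xs
distinct⁻ [] _ = []
distinct⁻ (x ∷ xs) e = let p , q = ∧-true⁻ (not (any (λ y → ⌊ x ≟F y ⌋) xs)) e in notAny⁻ x xs p ∷ distinct⁻ xs q

distinct⁺ : ∀ {n} {xs : List (Fin n)} → Unique xs → distinctᵇ xs ≡ true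
distinct⁺ [] = refl
distinct⁺ {xs = x ∷ xs} (x∉ ∷ u) rewrite notAny⁺ x∉ = distinct⁺ u

map-just-mapMaybe : {A B : Set} (f : A → Maybe B) (xs : List A) → All IsJust (map f xs) →
  map just (mapMaybe f xs) ≡ map f xs
map-just-mapMaybe f [] _ = refl
map-just-mapMaybe f (x ∷ xs) ((c , e) ∷ js) rewrite e = cong (just c ∷_) (map-just-mapMaybe f xs js)

module _ {n : ℕ} (G : ColouredGraph n) where

  private
    V = Fin n

  pathColours : List V → List (Maybe ℕ)
  pathColours [] = []
  pathColours (x ∷ []) = []
  pathColours (x ∷ y ∷ xs) = col G x y ∷ pathColours (y ∷ xs)

  -- The end `z` is kept apart from the inner vertices so that a closed walk cut at two vertices is
  -- a concatenation of two walks, which a rotation merely swaps.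
  walkColours : V → List V → V → List (Maybe ℕ)
  walkColours u [] z = col G u z ∷ []
  walkColours u (v ∷ us) z = col G u v ∷ walkColours v us z

  closedColours : List V → List (Maybe ℕ)
  closedColours [] = []
  closedColours (x ∷ xs) = walkColours x xs x

  walkColours-last : ∀ u us {z} → walkColours u us z ≡ pathColours (u ∷ us) ++ [ col G (last u us) z ]
  walkColours-last u [] = refl
  walkColours-last u (v ∷ us) = cong (col G u v ∷_) (walkColours-last v us)

  walkColours-++ : ∀ u us v vs {z} → walkColours u (us ++ v ∷ vs) z ≡ walkColours u us v ++ walkColours v vs z
  walkColours-++ u [] v vs = refl
  walkColours-++ u (w ∷ us) v vs = cong (col G u w ∷_) (walkColours-++ w us v vs)

  length-walkColours : ∀ u us {z} → length (walkColours u us z) ≡ suc (length us)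
  length-walkColours u [] = refl
  length-walkColours u (v ∷ us) = cong suc (length-walkColours v us)

  length-pathColours : ∀ u us → length (pathColours (u ∷ us)) ≡ length us
  length-pathColours u [] = refl
  length-pathColours u (v ∷ us) = cong suc (length-pathColours v us)

  closedColours-cyclePairs : ∀ xs → map (λ p → col G (proj₁ p) (proj₂ p)) (cyclePairs xs) ≡ closedColours xs
  closedColours-cyclePairs [] = refl
  closedColours-cyclePairs (x ∷ xs) = go x xs
    where
    go : ∀ u us {z} → map (λ p → col G (proj₁ p) (proj₂ p)) (zip (u ∷ us) (us ++ [ z ])) ≡ walkColours u us z
    go u [] = refl
    go u (v ∷ us) = cong (col G u v ∷_) (go v us)

  closedColours-rotate : ∀ us vs → closedColours (us ++ vs) ↭ closedColours (vs ++ us)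
  closedColours-rotate [] vs rewrite ++-identityʳ vs = _↭_.refl
  closedColours-rotate (u ∷ us) [] rewrite ++-identityʳ us = _↭_.refl
  closedColours-rotate (u ∷ us) (v ∷ vs)
    rewrite walkColours-++ u us v vs {u} | walkColours-++ v vs u us {v} =
      ++-comm (walkColours u us v) (walkColours v vs u)

  pathColours-∷ʳ : ∀ ys {b a} → pathColours (ys ++ b ∷ a ∷ []) ≡ pathColours (ys ++ b ∷ []) ++ [ col G b a ]
  pathColours-∷ʳ [] = refl
  pathColours-∷ʳ (y ∷ []) = refl
  pathColours-∷ʳ (y ∷ z ∷ ys) = cong (col G y z ∷_) (pathColours-∷ʳ (z ∷ ys))

  pathColours-reverse-∷ : ∀ x y xs →
    pathColours (reverse (x ∷ y ∷ xs)) ≡ pathColours (reverse (y ∷ xs)) ++ [ col G y x ]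
  pathColours-reverse-∷ x y xs
    rewrite unfold-reverse x (y ∷ xs) | unfold-reverse y xs | ++-assoc (reverse xs) [ y ] [ x ] =
      pathColours-∷ʳ (reverse xs)

  pathColours-reverse : ∀ xs → pathColours xs ↭ pathColours (reverse xs)
  pathColours-reverse [] = _↭_.refl
  pathColours-reverse (x ∷ []) = _↭_.refl
  pathColours-reverse (x ∷ y ∷ xs) = subst (pathColours (x ∷ y ∷ xs) ↭_)
    (sym (trans (pathColours-reverse-∷ x y xs) (cong (λ c → pathColours (reverse (y ∷ xs)) ++ [ c ]) (col-sym G y x))))
    (_↭_.trans (_↭_.prep _ (pathColours-reverse (y ∷ xs)))
      (++-comm [ col G x y ] (pathColours (reverse (y ∷ xs)))))

  Cycle : List V → Set
  Cycle xs = Unique xs × All IsJust (closedColours xs)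

  RainbowPath : List V → Set
  RainbowPath xs = Unique xs × Unique (pathColours xs) × All IsJust (pathColours xs)

  isCycle⁻ : ∀ {m} (vs : Vec V m) → isCycleᵇ G vs ≡ true → Cycle (toList vs)
  isCycle⁻ vs e = let p , q = ∧-true⁻ (distinctᵇ (toList vs)) e in
    distinct⁻ (toList vs) p ,
    subst (All IsJust) (closedColours-cyclePairs (toList vs))
      (All-map⁺ (All.map (λ {p} → is-just⁻ (col G (proj₁ p) (proj₂ p)))
        (all-true⁻ _ (cyclePairs (toList vs)) q)))

  isCycle⁺ : ∀ {m} (vs : Vec V m) → Cycle (toList vs) → isCycleᵇ G vs ≡ true
  isCycle⁺ vs (u , js) rewrite distinct⁺ u =
    all-true⁺ _ (All.map (λ { (c , e) → cong is-just e })
      (All-map⁻ (subst (All IsJust) (sym (closedColours-cyclePairs (toList vs))) js)))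

  map-just-cycleColours : ∀ {m} (vs : Vec V m) → Cycle (toList vs) →
    map just (cycleColours G vs) ≡ closedColours (toList vs)
  map-just-cycleColours vs (_ , js) = trans
    (map-just-mapMaybe _ (cyclePairs (toList vs))
      (subst (All IsJust) (sym (closedColours-cyclePairs (toList vs))) js))
    (closedColours-cyclePairs (toList vs))

  rainbow⁺ : ∀ {m} xs → length xs ≡ m → Cycle xs → Unique (closedColours xs) → HasRainbowCycle G m
  rainbow⁺ xs len cyc uc with vs , refl ← word xs len = vs , isCycle⁺ vs cyc ,
    AllPairs.map (λ ne e → ne (cong just e))
      (AllPairs-map⁻ (subst Unique (sym (map-just-cycleColours vs cyc)) uc))

  cycle-rotate : ∀ us vs → Cycle (us ++ vs) → Cycle (vs ++ us)
  cycle-rotate us vs (u , js) = unique-resp-↭ (++-comm us vs) u , All-resp-↭ (closedColours-rotate us vs) js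

  cycle-tail : ∀ {x y xs} → Cycle (x ∷ y ∷ xs) → Unique (y ∷ xs) × All IsJust (pathColours (y ∷ xs))
  cycle-tail {x} {y} {xs} (_ ∷ u , _ ∷ js) = u ,
    All-++⁻ˡ (pathColours (y ∷ xs)) (subst (All IsJust) (walkColours-last y xs) js)

  rainbow-tail : ∀ {x y xs} → Cycle (x ∷ y ∷ xs) → Unique (closedColours (x ∷ y ∷ xs)) → RainbowPath (y ∷ xs)
  rainbow-tail {x} {y} {xs} cyc (_ ∷ uc) = let u , js = cycle-tail cyc in u ,
    unique-++⁻ˡ (pathColours (y ∷ xs)) (subst Unique (walkColours-last y xs) uc) , js

  rainbowPath-reverse : ∀ {xs} → RainbowPath xs → RainbowPath (reverse xs)
  rainbowPath-reverse {xs} (u , uc , js) =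
    unique-resp-↭ (↭-sym (↭-reverse xs)) u ,
    unique-resp-↭ (pathColours-reverse xs) uc ,
    All-resp-↭ (pathColours-reverse xs) js

  last-edge : ∀ {x y xs} → Cycle (x ∷ y ∷ xs) → IsJust (col G (last y xs) x)
  last-edge {x} {y} {xs} (_ , _ ∷ js) = All.lookup (subst (All IsJust) (walkColours-last y xs) js)
    (∈-++⁺ʳ (pathColours (y ∷ xs)) (here refl))

-- Greedy prolongation of rainbow paths

path-length : ∀ j b → 4 + 2 * j + suc (2 * b) ≡ 2 * (2 + j + b) + 1
path-length = solve-∀

module _ {n : ℕ} (G : ColouredGraph n) (proper : Proper G) where

  private
    V = Fin n
    _∈?_ = DecMembership._∈?_ (_≟F_ {n})

  proper-injective : ∀ {u v w c} → col G u v ≡ just c → col G u w ≡ just c → v ≡ w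
  proper-injective {u} {v} {w} {c} e e' with v ≟F w
  ... | yes v≡w = v≡w
  ... | no v≢w = ⊥-elim (proper u v w c v≢w e e')

  proper-injectiveˡ : ∀ {u v w} → IsJust (col G v u) → col G v u ≡ col G w u → v ≡ w
  proper-injectiveˡ {u} {v} {w} (c , e) e' =
    proper-injective (trans (col-sym G u v) e) (trans (col-sym G u w) (trans (sym e') e))

  neighbours : V → Maybe ℕ → List V
  neighbours v nothing = []
  neighbours v (just c) = filter (λ w → Maybe-≡-dec Data.Nat._≟_ (col G v w) (just c)) (allFin n)

  length-neighbours : ∀ v c → length (neighbours v c) ≤ 1
  length-neighbours v nothing = z≤n
  length-neighbours v (just c) = bounded-rel {Q = _∈ tt ∷ []} (λ w _ → col G v w ≡ just c)
    proper-injective (λ e → tt , here refl , e) (bounded-∈ (tt ∷ []))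
    (neighbours v (just c)) (Unique.filter⁺ coloured? (Unique.allFin⁺ n))
    (All.tabulate (λ w∈ → proj₂ (∈-filter⁻ coloured? {xs = allFin n} w∈)))
    where coloured? = λ w → Maybe-≡-dec Data.Nat._≟_ (col G v w) (just c)

  length-concatMap-neighbours : ∀ v cs → length (concatMap (neighbours v) cs) ≤ length cs
  length-concatMap-neighbours v [] = z≤n
  length-concatMap-neighbours v (c ∷ cs) = subst (_≤ suc (length cs)) (sym (length-++ (neighbours v c)))
    (+-mono-≤ (length-neighbours v c) (length-concatMap-neighbours v cs))

  forbidden : V → V → List V → List V
  forbidden u s p = p ++ concatMap (neighbours u) (pathColours G p) ++ concatMap (neighbours s) (pathColours G p)

  length-forbidden : ∀ {m} u s x xs → length (x ∷ xs) ≤ m → length (forbidden u s (x ∷ xs)) ≤ 3 * m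
  length-forbidden {m} u s x xs le =
    subst (_≤ 3 * m) (sym (trans (length-++ (x ∷ xs))
      (cong (length (x ∷ xs) +_) (length-++ (concatMap (neighbours u) (pathColours G (x ∷ xs)))))))
    (+-mono-≤ le (+-mono-≤ (colours≤ u) (subst (_ ≤_) (sym (+-identityʳ m)) (colours≤ s))))
    where
    colours≤ : ∀ v → length (concatMap (neighbours v) (pathColours G (x ∷ xs))) ≤ m
    colours≤ v = ≤-trans (length-concatMap-neighbours v (pathColours G (x ∷ xs)))
      (subst (_≤ m) (sym (length-pathColours G x xs)) (≤-trans (n≤1+n _) le))

  ∈-neighbours : ∀ {v w cs} → IsJust (col G v w) → col G v w ∈ cs → w ∈ concatMap (neighbours v) cs
  ∈-neighbours {v} {w} (c , e) ∈cs = ∈-concatMap⁺ (neighbours v) (Any.map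
    (λ { refl → subst (λ d → w ∈ neighbours v d) (sym e)
         (∈-filter⁺ (λ w → Maybe-≡-dec Data.Nat._≟_ (col G v w) (just c)) (∈-allFin w) e) }) ∈cs)

  module _ {u s w : V} {p : List V} (w∉ : w ∉ forbidden u s p) where

    fresh-vertex : All (w ≢_) p
    fresh-vertex = ¬Any⇒All¬ p (w∉ ∘ ∈-++⁺ˡ)

    fresh-colourˡ : IsJust (col G u w) → col G u w ∉ pathColours G p
    fresh-colourˡ j c∈ = w∉ (∈-++⁺ʳ p (∈-++⁺ˡ (∈-neighbours j c∈)))

    fresh-colourʳ : IsJust (col G s w) → col G s w ∉ pathColours G p
    fresh-colourʳ j c∈ = w∉ (∈-++⁺ʳ p (∈-++⁺ʳ (concatMap (neighbours u) (pathColours G p)) (∈-neighbours j c∈)))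

  extend : ∀ {u w p} → RainbowPath G (u ∷ p) → All (w ≢_) (u ∷ p) → IsJust (col G u w) →
    col G u w ∉ pathColours G (u ∷ p) → RainbowPath G (w ∷ u ∷ p)
  extend {u} {w} (uq , uc , js) w∉ j c∉ rewrite col-sym G u w =
    w∉ ∷ uq , ¬Any⇒All¬ _ c∉ ∷ uc , j ∷ js

  -- The two added edges share `w`, so properness gives them different colours as soon as `u ≢ s`;
  -- the colours of the path are avoided by assumption.
  close : ∀ {u w p s m} → RainbowPath G (u ∷ p) → last u p ≡ s → u ≢ s → All (w ≢_) (u ∷ p) →
    IsJust (col G u w) → col G u w ∉ pathColours G (u ∷ p) →
    IsJust (col G s w) → col G s w ∉ pathColours G (u ∷ p) →
    length (w ∷ u ∷ p) ≡ m → HasRainbowCycle G m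
  close {u} {w} {p} (uq , uc , js) refl u≢s w∉ j c∉ j' c'∉ len =
    rainbow⁺ G (w ∷ u ∷ p) len (w∉ ∷ uq , subst (All IsJust) colours (wu ∷ All-++⁺ js (j' ∷ [])))
      (subst Unique colours
        (All-++⁺ (¬Any⇒All¬ _ (c∉ ∘ subst (_∈ pathColours G (u ∷ p)) (col-sym G w u)))
          ((λ e → u≢s (proper-injective (proj₂ wu) (trans (col-sym G w _) (trans (sym e) (proj₂ wu))))) ∷ [])
        ∷ unique-∷ʳ uc c'∉))
    where
    wu : IsJust (col G w u)
    wu = subst IsJust (col-sym G u w) j
    colours : col G w u ∷ pathColours G (u ∷ p) ++ [ col G (last u p) w ] ≡ closedColours G (w ∷ u ∷ p)
    colours = cong (col G w u ∷_) (sym (walkColours-last G u p))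
    unique-∷ʳ : ∀ {cs : List (Maybe ℕ)} {c} → Unique cs → c ∉ cs → Unique (cs ++ [ c ])
    unique-∷ʳ {cs} {c} ucs c∉cs =
      unique-resp-↭ (++-comm [ c ] cs) (¬Any⇒All¬ cs c∉cs ∷ ucs)

  -- A rainbow path from s to u is prolonged greedily by alternating along the
  -- pairs of B and is finally closed up at s.
  module _ (k : ℕ) (rainbow-free : ¬ HasRainbowCycle G (2 * k + 1)) {s : V} (B : V → V → Set)
    (B-edge : ∀ {u w} → B u w → IsJust (col G u w) × IsJust (col G s w))
    (many-right : ∀ {u w} → B u w → ∀ F → length F ≤ 3 * (2 * k + 1) → (∀ {w'} → B u w' → w' ∈ F) → ⊥)
    (many-left : ∀ {u w} → B u w → ∀ F → length F ≤ 3 * (2 * k + 1) → (∀ {u'} → B u' w → u' ∈ F) → ⊥)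
    where

    -- Every `w` with `B u w` is adjacent to `s` as well, so the cycle can be closed at any fresh
    -- `w` once the length is right. The number `b` counts the rounds still to be made, each adding
    -- a `w` and then a `u`; one last `w` closes the cycle.
    bounce : ∀ b {u w p} → B u w → RainbowPath G (u ∷ p) → last u p ≡ s → u ≢ s →
      length (u ∷ p) + suc (2 * b) ≡ 2 * k + 1 → ⊥
    bounce b {u} {_} {p} Buw path lst u≢s len =
      -- A fresh `w` is found indirectly: the goal is `⊥`, so if each fresh `w` can be refuted,
      -- `forbidden` covers all partners of `u`, which it is too short to do.
      many-right Buw (forbidden u s (u ∷ p)) (length-forbidden u s u p |p|≤)
        λ {w} Buw' → decidable-stable (w ∈? _) (step b len Buw')
      where
      |p|≤ : length (u ∷ p) ≤ 2 * k + 1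
      |p|≤ = subst (length (u ∷ p) ≤_) len (m≤m+n _ _)

      step : ∀ b {w} → length (u ∷ p) + suc (2 * b) ≡ 2 * k + 1 → B u w → ¬ w ∉ forbidden u s (u ∷ p)
      step zero len Buw w∉ = let j , j' = B-edge Buw in rainbow-free
        (close path lst u≢s (fresh-vertex w∉) j (fresh-colourˡ {u} w∉ j) j' (fresh-colourʳ {u} w∉ j')
          (trans (sym (+-comm (length (u ∷ p)) 1)) len))
      step (suc b) {w} len Buw w∉ =
        many-left Buw (forbidden w w (w ∷ u ∷ p)) (length-forbidden w w w (u ∷ p) |wp|≤)
          λ {u'} Bu'w → decidable-stable (u' ∈? _) λ u'∉ →
            let j' = subst IsJust (col-sym G u' w) (proj₁ (B-edge Bu'w)) in
            bounce b Bu'w (extend path' (fresh-vertex u'∉) j' (fresh-colourˡ u'∉ j')) lst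
              (λ { refl → All¬⇒¬Any (fresh-vertex u'∉) (there (subst (_∈ u ∷ p) lst (last-∈ u p))) })
              (trans (sym len') len)
        where
        j = proj₁ (B-edge Buw)
        path' = extend path (fresh-vertex w∉) j (fresh-colourˡ {u} w∉ j)
        len' : length (u ∷ p) + suc (2 * suc b) ≡ suc (suc (length (u ∷ p))) + suc (2 * b)
        len' rewrite +-suc b (b + 0) | +-suc (length p) (suc (suc (b + (b + 0))))
          | +-suc (length p) (suc (b + (b + 0))) = refl
        |wp|≤ : length (w ∷ u ∷ p) ≤ 2 * k + 1
        |wp|≤ = subst (length (w ∷ u ∷ p) ≤_) (trans (sym len') len) (≤-trans (n≤1+n _) (m≤m+n _ _))

  module _ (j b : ℕ) where

    -- m: a path on at most 2k + 1 vertices excludes its own vertices and, for each of its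
    -- colours, at most one neighbour of either end.
    private
      k = 2 + j + b
      m = 3 * (2 * k + 1)

      -- Every core supplies a rainbow path on all but one vertex of a cycle, that is, on
      -- `4 + 2 * j` vertices. The cycle sought has `2 * b + 1` more: `b` rounds of two and the
      -- closing vertex.
      long-enough : ∀ {i} → i ≡ 4 + 2 * j → i + suc (2 * b) ≡ 2 * k + 1
      long-enough refl = path-length j b

    module _ (rainbow-free : ¬ HasRainbowCycle G (2 * k + 1)) where

      -- Rainbow cycles of the counted length

      Quad = V × V × V × V × List V

      RainbowCycle : Quad → Set
      RainbowCycle (x₁ , x₂ , x₃ , x₄ , r) = length r ≡ suc (2 * j) ×
        Cycle G (x₁ ∷ x₂ ∷ x₃ ∷ x₄ ∷ r) × Unique (closedColours G (x₁ ∷ x₂ ∷ x₃ ∷ x₄ ∷ r))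

      -- All four combinations occur because it is not known in advance which of the edges `x₁x₂`
      -- and `x₃x₄` will serve for the alternation. The `3 + 2 * j` vertices that remain give the
      -- exponent of the bound.
      kept : Fin 4 → Quad → List V
      kept zero (x₁ , x₂ , x₃ , x₄ , r) = x₂ ∷ x₄ ∷ r
      kept (suc zero) (x₁ , x₂ , x₃ , x₄ , r) = x₂ ∷ x₃ ∷ r
      kept (suc (suc zero)) (x₁ , x₂ , x₃ , x₄ , r) = x₁ ∷ x₄ ∷ r
      kept (suc (suc (suc zero))) (x₁ , x₂ , x₃ , x₄ , r) = x₁ ∷ x₃ ∷ r

      varied : Fin 4 → Quad → V × V
      varied zero (x₁ , x₂ , x₃ , x₄ , r) = x₁ , x₃
      varied (suc zero) (x₁ , x₂ , x₃ , x₄ , r) = x₁ , x₄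
      varied (suc (suc zero)) (x₁ , x₂ , x₃ , x₄ , r) = x₂ , x₃
      varied (suc (suc (suc zero))) (x₁ , x₂ , x₃ , x₄ , r) = x₂ , x₄

      length-kept : ∀ i {x} → RainbowCycle x → length (kept i x) ≡ 3 + 2 * j
      length-kept zero (len , _) = cong (2 +_) len
      length-kept (suc zero) (len , _) = cong (2 +_) len
      length-kept (suc (suc zero)) (len , _) = cong (2 +_) len
      length-kept (suc (suc (suc zero))) (len , _) = cong (2 +_) len

      kept-varied-injective : ∀ i {x y} → RainbowCycle x → RainbowCycle y →
        kept i x ≡ kept i y → varied i x ≡ varied i y → x ≡ y
      kept-varied-injective zero _ _ refl refl = refl
      kept-varied-injective (suc zero) _ _ refl refl = refl
      kept-varied-injective (suc (suc zero)) _ _ refl refl = refl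
      kept-varied-injective (suc (suc (suc zero))) _ _ refl refl = refl

      module _ (ys : List Quad) (cycles : All RainbowCycle ys)
        (uncoverable : Uncoverable (3 + 2 * j) (m * m) RainbowCycle kept varied length-kept kept-varied-injective ys)
        (s : V) (r' : List V) where

        private
          r = s ∷ r'
          t = last s r'

          cover-size : (F F' : List V) → length F ≤ m → length F' ≤ m →
            length (cartesianProduct F F') ≤ m * m
          cover-size F F' le le' = subst (_≤ m * m) (sym (length-cartesianProduct F F')) (*-mono-≤ le le')

        module _ {x₁ x₂ x₃ x₄ : V} (x∈ : (x₁ , x₂ , x₃ , x₄ , r) ∈ ys) where
          private
            x-cycle = proj₁ (proj₂ (All.lookup cycles x∈))
            x-path : RainbowPath G (x₂ ∷ x₃ ∷ x₄ ∷ r)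
            x-path = rainbow-tail G x-cycle (proj₂ (proj₂ (All.lookup cycles x∈)))
            x-len : length (x₂ ∷ x₃ ∷ x₄ ∷ r) + suc (2 * b) ≡ 2 * k + 1
            x-len = long-enough (cong (3 +_) (proj₁ (All.lookup cycles x∈)))
            x₂≢t : x₂ ≢ t
            x₂≢t refl with (_ ∷ _ ∷ x₂∉) ∷ _ ← proj₁ x-path = All¬⇒¬Any x₂∉ (last-∈ s r')

          -- If `F` covers the `x₄` seen by this `x₃`, a short cover `F'` of `x₁` or of `x₂` would
          -- yield the cover of pairs by the product of `F'` and `F`, of size at most `m * m`. So
          -- `x₁` and `x₂` see many of each other, and the path `x₂ x₃ x₄ r` with fixed end `t` is
          -- prolonged by alternating between them.
          ¬few-x₄ : ∀ F → length F ≤ m → (∀ {a b w} → (a , b , x₃ , w , r) ∈ ys → w ∈ F) → ⊥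
          -- The fourth vertex `w` may change along the way: only the edges from `u` to `v` and to
          -- `t` are used.
          ¬few-x₄ F |F|≤ cover = bounce k rainbow-free (λ v u → ∃ λ w → (u , v , x₃ , w , r) ∈ ys)
            (λ { (w , y∈) → let cyc = proj₁ (proj₂ (All.lookup cycles y∈)) in
                 subst IsJust (col-sym G _ _) (All.head (proj₂ cyc)) , last-edge G cyc })
            (λ { (w , y∈) F' |F'|≤ cover' → uncoverable (suc zero) y∈ (cartesianProduct F' F) (cover-size F' F |F'|≤ |F|≤)
                 λ { z∈ refl → ∈-cartesianProduct⁺ (cover' (_ , z∈)) (cover z∈) } })
            (λ { (w , y∈) F' |F'|≤ cover' → uncoverable (suc (suc (suc zero))) y∈ (cartesianProduct F' F) (cover-size F' F |F'|≤ |F|≤)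
                 λ { z∈ refl → ∈-cartesianProduct⁺ (cover' (_ , z∈)) (cover z∈) } })
            b (x₄ , x∈) x-path refl x₂≢t x-len

          ¬few-x₃ : ∀ F → length F ≤ m → (∀ {a b u} → (a , b , u , x₄ , r) ∈ ys → u ∈ F) → ⊥
          ¬few-x₃ F |F|≤ cover = bounce k rainbow-free (λ v u → ∃ λ w → (u , v , w , x₄ , r) ∈ ys)
            (λ { (w , y∈) → let cyc = proj₁ (proj₂ (All.lookup cycles y∈)) in
                 subst IsJust (col-sym G _ _) (All.head (proj₂ cyc)) , last-edge G cyc })
            (λ { (w , y∈) F' |F'|≤ cover' → uncoverable zero y∈ (cartesianProduct F' F) (cover-size F' F |F'|≤ |F|≤)
                 λ { z∈ refl → ∈-cartesianProduct⁺ (cover' (_ , z∈)) (cover z∈) } })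
            (λ { (w , y∈) F' |F'|≤ cover' → uncoverable (suc (suc zero)) y∈ (cartesianProduct F' F) (cover-size F' F |F'|≤ |F|≤)
                 λ { z∈ refl → ∈-cartesianProduct⁺ (cover' (_ , z∈)) (cover z∈) } })
            b (x₃ , x∈) x-path refl x₂≢t x-len

        -- Since neither side has few partners, every `x₃` sees many `x₄` and conversely. The cycle
        -- without `x₄` is a path between `s` and `x₃`, the two neighbours of `x₄`, as the
        -- alternation needs.
        core-empty : ∀ {x₁ x₂ x₃ x₄} → (x₁ , x₂ , x₃ , x₄ , r) ∈ ys → ⊥
        core-empty {x₁} {x₂} {x₃} {x₄} x∈ = bounce k rainbow-free (λ u w → ∃ λ a → ∃ λ b → (a , b , u , w , r) ∈ ys)
            (λ { {u} {w} (_ , _ , y∈) → edges (proj₂ (proj₁ (proj₂ (All.lookup cycles y∈)))) })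
            (λ { (_ , _ , y∈) F |F|≤ cover → ¬few-x₄ y∈ F |F|≤ λ z∈ → cover (_ , _ , z∈) })
            (λ { (_ , _ , y∈) F |F|≤ cover → ¬few-x₃ y∈ F |F|≤ λ z∈ → cover (_ , _ , z∈) })
            b (x₁ , x₂ , x∈) path lst x₃≢s (long-enough len)
          where
          edges : ∀ {a b u w xs} → All IsJust (closedColours G (a ∷ b ∷ u ∷ w ∷ s ∷ xs)) →
            IsJust (col G u w) × IsJust (col G s w)
          edges {w = w} (_ ∷ _ ∷ uw ∷ ws ∷ _) = uw , subst IsJust (col-sym G w s) ws
          x-cycle = proj₂ (All.lookup cycles x∈)
          turned = cycle-rotate G (x₁ ∷ x₂ ∷ x₃ ∷ []) (x₄ ∷ r) (proj₁ x-cycle)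
          backwards : reverse (r ++ x₁ ∷ x₂ ∷ x₃ ∷ []) ≡ x₃ ∷ x₂ ∷ x₁ ∷ reverse r
          backwards = reverse-++ r (x₁ ∷ x₂ ∷ x₃ ∷ [])
          path : RainbowPath G (x₃ ∷ x₂ ∷ x₁ ∷ reverse r)
          path = subst (RainbowPath G) backwards (rainbowPath-reverse G {r ++ x₁ ∷ x₂ ∷ x₃ ∷ []}
            (rainbow-tail G turned (unique-resp-↭
              (closedColours-rotate G (x₁ ∷ x₂ ∷ x₃ ∷ []) (x₄ ∷ r)) (proj₂ x-cycle))))
          lst : last x₃ (x₂ ∷ x₁ ∷ reverse r) ≡ s
          lst rewrite unfold-reverse s r' = last-++ x₁ (reverse r')
          x₃≢s : x₃ ≢ s
          x₃≢s refl with _ ∷ _ ∷ (_ ∷ ne ∷ _) ∷ _ ← proj₁ (proj₁ x-cycle) = ne refl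
          len : length (x₃ ∷ x₂ ∷ x₁ ∷ reverse r) ≡ 4 + 2 * j
          len = cong (3 +_) (trans (length-reverse r) (proj₁ (All.lookup cycles x∈)))

      bounded-rainbowCycles : Bounded RainbowCycle (m * m * (4 * n ^ (3 + 2 * j)))
      bounded-rainbowCycles = bounded-coreless (3 + 2 * j) (m * m) RainbowCycle kept varied
        length-kept kept-varied-injective
        λ { ys cycles unc {_ , _ , _ , _ , []} x∈ → case proj₁ (All.lookup cycles x∈) of λ ()
          ; ys cycles unc {_ , _ , _ , _ , s ∷ r'} x∈ → core-empty ys cycles unc s r' x∈ }

      -- Cycles whose closing colour recurs on a rainbow path

      Chain = V × V × List V × V × V × List V

      -- The cycle a v g d c h in which the closing edge, from the end of c ∷ h to a,
      -- repeats the colour of dc, and no other colour is repeated away from a.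
      RepeatCycle : ℕ → ℕ → Chain → Set
      RepeatCycle p q (a , v , g , d , c , h) = length g ≡ p × length h ≡ q ×
        Cycle G (a ∷ v ∷ g ++ d ∷ c ∷ h) × Unique (pathColours G (v ∷ g ++ d ∷ c ∷ h)) ×
        col G d c ≡ col G (last c h) a

      module _ (p q : ℕ) (p+q : p + q ≡ suc (2 * j)) where

        rest : Fin 2 → Chain → List V
        rest zero (a , v , g , d , c , h) = g ++ d ∷ c ∷ h
        rest (suc zero) (a , v , g , d , c , h) = v ∷ g ++ c ∷ h

        free : Fin 2 → Chain → V
        free zero (a , v , g , d , c , h) = v
        free (suc zero) (a , v , g , d , c , h) = a

        length-rest : ∀ i {x} → RepeatCycle p q x → length (rest i x) ≡ 3 + 2 * j
        length-rest zero {a , v , g , d , c , h} (refl , refl , _) =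
          trans (length-++ g) (trans (+-suc _ _) (cong suc (trans (+-suc _ _) (cong suc p+q))))
        length-rest (suc zero) {a , v , g , d , c , h} (refl , refl , _) =
          cong suc (trans (length-++ g) (trans (+-suc _ _) (cong suc p+q)))

        closing-edge : ∀ {a v g d c h} → RepeatCycle p q (a , v , g , d , c , h) → IsJust (col G (last c h) a)
        closing-edge {a} {v} {g} (_ , _ , cyc , _) = subst (λ l → IsJust (col G l a)) (last-++ v g) (last-edge G cyc)

        a-determined : ∀ {a v g d c h a' v'} → RepeatCycle p q (a , v , g , d , c , h) →
          RepeatCycle p q (a' , v' , g , d , c , h) → a ≡ a'
        a-determined x@(_ , _ , _ , _ , e) (_ , _ , _ , _ , e') with closing-edge x
        ... | l , el = proper-injective el (trans (sym e') (trans e el))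

        rest-free-injective : ∀ i {x y} → RepeatCycle p q x → RepeatCycle p q y →
          rest i x ≡ rest i y → free i x ≡ free i y → x ≡ y
        rest-free-injective zero {_ , _ , g , _} {_ , _ , g' , _} x@(lg , _) y@(lg' , _) e refl
          with refl , refl ← ++-injective g g' (trans lg (sym lg')) e
          with refl ← a-determined x y = refl
        rest-free-injective (suc zero) {a , v , g , d , c , h} {_ , _ , g' , d' , _}
          x@(lg , _ , _ , _ , r) y@(lg' , _ , _ , _ , r') e refl
          with refl , e' ← ∷-injective e
          with refl , refl ← ++-injective g g' (trans lg (sym lg')) e'
          with refl ← proper-injectiveˡ {c} {d} {d'} (subst IsJust (sym r) (closing-edge x)) (trans r (sym r')) = refl

        repeat-core-empty : ∀ ys → All (RepeatCycle p q) ys →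
          Uncoverable (3 + 2 * j) m (RepeatCycle p q) rest free length-rest rest-free-injective ys →
          ∀ {x} → x ∈ ys → ⊥
        repeat-core-empty ys cycles uncoverable {a , v , g , d , c , h} x∈ =
          -- `d` is left open in the relation because it moves with `a`; the path being prolonged
          -- keeps the `d` it started with.
          bounce k rainbow-free (λ u w → ∃ λ d → (w , u , g , d , c , h) ∈ ys)
            (λ { (_ , y∈) → let y = All.lookup cycles y∈ in
                 subst IsJust (col-sym G _ _) (All.head (proj₂ (proj₁ (proj₂ (proj₂ y))))) , closing-edge y })
            many-a many-v b (d , x∈)
            (proj₁ path , proj₁ (proj₂ (proj₂ (proj₂ x))) , proj₂ path) (last-++ v g) v≢last
            (long-enough (cong suc (length-rest zero x)))
          where
          x = All.lookup cycles x∈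
          path = cycle-tail G (proj₁ (proj₂ (proj₂ x)))

          v≢last : v ≢ last c h
          v≢last refl with v∉ ∷ _ ← proj₁ path = All¬⇒¬Any v∉ (∈-++⁺ʳ g (there (last-∈ c h)))

          many-a : ∀ {u w} → (∃ λ d → (w , u , g , d , c , h) ∈ ys) → ∀ F → length F ≤ m →
            (∀ {w'} → (∃ λ d → (w' , u , g , d , c , h) ∈ ys) → w' ∈ F) → ⊥
          many-a {u} {w} (d' , y∈) F le cover = uncoverable (suc zero) y∈ F le covered
            where
            covered : ∀ {z} → z ∈ ys → rest (suc zero) z ≡ rest (suc zero) (w , u , g , d' , c , h) → free (suc zero) z ∈ F
            covered {_ , _ , g' , _} z∈ e
              with refl , e' ← ∷-injective e
              with refl , refl ← ++-injective g' g
                (trans (proj₁ (All.lookup cycles z∈)) (sym (proj₁ x))) e' = cover (_ , z∈)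

          many-v : ∀ {u w} → (∃ λ d → (w , u , g , d , c , h) ∈ ys) → ∀ F → length F ≤ m →
            (∀ {u'} → (∃ λ d → (w , u' , g , d , c , h) ∈ ys) → u' ∈ F) → ⊥
          many-v {u} {w} (d' , y∈) F le cover = uncoverable zero y∈ F le covered
            where
            covered : ∀ {z} → z ∈ ys → rest zero z ≡ rest zero (w , u , g , d' , c , h) → free zero z ∈ F
            covered {_ , _ , g' , _} z∈ e
              with refl , refl ← ++-injective g' g
                (trans (proj₁ (All.lookup cycles z∈)) (sym (proj₁ x))) e
              -- The edge `dc` is kept here, so all these cycles share `a`, and the varied `v` are
              -- partners of one and the same vertex.
              with refl ← a-determined (All.lookup cycles z∈) (All.lookup cycles y∈) = cover (_ , z∈)

        bounded-repeatCycles : Bounded (RepeatCycle p q) (m * (2 * n ^ (3 + 2 * j)))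
        bounded-repeatCycles = bounded-coreless (3 + 2 * j) m (RepeatCycle p q) rest free
          length-rest rest-free-injective repeat-core-empty

-- Cycles with repeated colours, and the count of all cycles

++-∷-injective : {A : Set} (xs xs' : List A) {y y' : A} {ys ys' : List A} → length xs ≡ length xs' →
  xs ++ y ∷ ys ≡ xs' ++ y' ∷ ys' → y ≡ y'
++-∷-injective xs xs' len e = ∷-injectiveˡ (proj₂ (++-injective xs xs' len e))

unique-or-repeat : {A : Set} → DecidableEquality A → (xs : List A) →
  Unique xs ⊎ (∃ λ as → ∃ λ c → ∃ λ bs → ∃ λ ds → xs ≡ as ++ c ∷ bs ++ c ∷ ds)
unique-or-repeat _≟_ [] = inj₁ []
unique-or-repeat _≟_ (x ∷ xs) with DecMembership._∈?_ _≟_ x xs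
... | yes x∈ = let bs , ds , e = ∈-∃++ x∈ in inj₂ ([] , x , bs , ds , cong (x ∷_) e)
... | no x∉ with unique-or-repeat _≟_ xs
... | inj₁ u = inj₁ (¬Any⇒All¬ xs x∉ ∷ u)
... | inj₂ (as , c , bs , ds , e) = inj₂ (x ∷ as , c , bs , ds , cong (x ∷_) e)

repeat⇒¬unique : {A : Set} (as : List A) {c : A} {bs ds : List A} → ¬ Unique (as ++ c ∷ bs ++ c ∷ ds)
repeat⇒¬unique as {bs = bs} u with c∉ ∷ _ ← unique-++⁻ʳ as u = All¬⇒¬Any c∉ (∈-insert bs)

split-at : {A : Set} (i : ℕ) {k : ℕ} (xs : List A) → length xs ≡ i + k →
  ∃ λ us → ∃ λ vs → xs ≡ us ++ vs × length us ≡ i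
split-at zero xs _ = [] , xs , refl , refl
split-at (suc i) (x ∷ xs) len =
  let us , vs , e , l = split-at i xs (suc-injective len) in x ∷ us , vs , cong (x ∷_) e , cong suc l

module _ {n : ℕ} (G : ColouredGraph n) where

  private
    V = Fin n

  length-closedColours : ∀ xs → length (closedColours G xs) ≡ length xs
  length-closedColours [] = refl
  length-closedColours (x ∷ xs) = length-walkColours G x xs

  -- Each colour belongs to the edge leaving the vertex at the same position, so any split of the
  -- colours lifts to a split of the vertices.
  rotate-to : ∀ xs as bs → closedColours G xs ≡ as ++ bs →
    ∃ λ us → ∃ λ vs → xs ≡ us ++ vs × length us ≡ length as × closedColours G (vs ++ us) ≡ bs ++ as
  rotate-to xs as bs e with us , vs , refl , len ← split-at (length as) {length bs} xs
    (trans (sym (length-closedColours xs)) (trans (cong length e) (length-++ as))) =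
      us , vs , refl , len , rotated us vs as bs len e
    where
    rotated : ∀ us vs as bs → length us ≡ length as →
      closedColours G (us ++ vs) ≡ as ++ bs → closedColours G (vs ++ us) ≡ bs ++ as
    rotated [] vs [] bs _ e rewrite ++-identityʳ vs | ++-identityʳ bs = e
    rotated (u ∷ us) [] as bs len e rewrite ++-identityʳ us
      with ++-injective (walkColours G u us u) as (trans (length-walkColours G u us) len) (trans (++-identityʳ _) e)
    ... | e' , refl = e'
    rotated (u ∷ us) (v ∷ vs) as bs len e
      with ++-injective (walkColours G u us v) as (trans (length-walkColours G u us) len)
             (trans (sym (walkColours-++ G u us v vs)) e)
    ... | e₁ , e₂ = trans (walkColours-++ G v vs u us) (cong₂ _++_ e₂ e₁)

  edge-of-colour : ∀ xs as {c bs} → pathColours G xs ≡ as ++ c ∷ bs →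
    ∃ λ g → ∃ λ d → ∃ λ e → ∃ λ h → xs ≡ g ++ d ∷ e ∷ h × col G d e ≡ c
  edge-of-colour [] [] ()
  edge-of-colour [] (_ ∷ _) ()
  edge-of-colour (x ∷ []) [] ()
  edge-of-colour (x ∷ []) (_ ∷ _) ()
  edge-of-colour (x ∷ y ∷ xs) [] e = [] , x , y , xs , refl , ∷-injectiveˡ e
  edge-of-colour (x ∷ y ∷ xs) (a ∷ as) e =
    let g , d , e' , h , eq , c = edge-of-colour (y ∷ xs) as (∷-injectiveʳ e)
    in x ∷ g , d , e' , h , cong (x ∷_) eq , c

  pathColours-tail : ∀ {x} xs {c cs} → pathColours G (x ∷ xs) ≡ c ∷ cs → pathColours G xs ≡ cs
  pathColours-tail (_ ∷ _) e = ∷-injectiveʳ e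

  data Repeating : List V → Set where
    here : ∀ {x y xs} → col G x y ∈ pathColours G (y ∷ xs) → Repeating (x ∷ y ∷ xs)
    there : ∀ {x xs} → Repeating xs → Repeating (x ∷ xs)

  unique-or-repeating : ∀ xs → Unique (pathColours G xs) ⊎ Repeating xs
  unique-or-repeating [] = inj₁ []
  unique-or-repeating (x ∷ []) = inj₁ []
  unique-or-repeating (x ∷ y ∷ xs) with unique-or-repeating (y ∷ xs)
  ... | inj₂ r = inj₂ (there r)
  ... | inj₁ u with DecMembership._∈?_ (Maybe-≡-dec Data.Nat._≟_) (col G x y) (pathColours G (y ∷ xs))
  ... | yes c∈ = inj₂ (here c∈)
  ... | no c∉ = inj₁ (¬Any⇒All¬ _ c∉ ∷ u)

  module _ (proper : Proper G) where

    -- The position of the repeated colour, one of at most `m`, fixes that colour, and properness at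
    -- `end y ys` then fixes `x`: this vertex costs a factor `m` instead of `n`. Taking the first
    -- vertex as `end` treats a repetition within a path; taking `last` treats the closing edge.
    bounded-determined : (end : V → List V → V) {Q : List V → Set} {M : ℕ} (m : ℕ) → Bounded Q M →
      Bounded (λ xs → ∃ λ x → ∃ λ y → ∃ λ ys → xs ≡ x ∷ y ∷ ys × Q (y ∷ ys) × length ys ≤ m ×
        IsJust (col G x (end y ys)) × col G x (end y ys) ∈ pathColours G (y ∷ ys)) (m * M)
    bounded-determined end {Q} m bQ xs uxs all =
      bounded-∃ {P = λ i xs → ∃ λ zs → Q zs × R i xs zs} m
        (λ i _ → bounded-rel (R i) R-injective id bQ) xs uxs
        (All.map (λ { (x , y , ys , refl , q , len , j , c∈) →
          let as , bs , e = ∈-∃++ c∈ in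
          length as ,
          ≤-trans (subst (suc (length as) ≤_) (trans (cong suc (sym (length-++ as)))
              (trans (sym (+-suc-length as bs)) (trans (sym (cong length e)) (length-pathColours G y ys))))
            (s≤s (m≤m+n _ _))) len ,
          y ∷ ys , q , x , y , ys , refl , refl , j , as , bs , refl , e }) all)
      where
      +-suc-length : ∀ {c : Maybe ℕ} as bs → length (as ++ c ∷ bs) ≡ suc (length (as ++ bs))
      +-suc-length [] bs = refl
      +-suc-length (a ∷ as) bs = cong suc (+-suc-length as bs)
      R : ℕ → List V → List V → Set
      R i xs zs = ∃ λ x → ∃ λ y → ∃ λ ys → xs ≡ x ∷ y ∷ ys × zs ≡ y ∷ ys × IsJust (col G x (end y ys)) ×
        ∃ λ as → ∃ λ bs → length as ≡ i × pathColours G (y ∷ ys) ≡ as ++ col G x (end y ys) ∷ bs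
      R-injective : ∀ {i xs xs' zs} → R i xs zs → R i xs' zs → xs ≡ xs'
      R-injective (x , y , ys , refl , refl , j , as , bs , len , e) (x' , _ , _ , refl , refl , _ , as' , bs' , len' , e') =
        cong (_∷ y ∷ ys) (proper-injectiveˡ G proper j
          (++-∷-injective as as' (trans len (sym len')) (trans (sym e) e')))

    RepeatingPath : ℕ → List V → Set
    RepeatingPath m xs = length xs ≡ m × All IsJust (pathColours G xs) × Repeating xs

    -- Induction on the number of vertices. If the first colour recurs, the first vertex is
    -- determined up to a bounded choice; if the repetition lies further on, the first vertex is
    -- free and costs `n`. Either way one power of `n` is saved.
    bounded-repeatingPaths : ∀ m → Bounded (RepeatingPath m) (m * m * n ^ (m ∸ 1))
    bounded-repeatingPaths zero = bounded-⊥ λ { {[]} (_ , _ , ()) ; {_ ∷ _} (() , _) }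
    bounded-repeatingPaths (suc m) xs uxs all = ≤-trans
      (bounded-⊎
        (bounded-determined (λ y _ → y) m (bounded-words n m))
        (bounded-∃ {P = λ i xs → ∃ λ ys → RepeatingPath m ys × R i xs ys} n
          (λ i _ → bounded-rel (R i)
            (λ { (x , ex , refl) (x' , ex' , refl) → cong (_∷ _) (toℕ-injective (trans ex (sym ex'))) })
            id (bounded-repeatingPaths m)))
        xs uxs (All.map classify all))
      (arithmetic m)
      where
      R : ℕ → List V → List V → Set
      R i xs ys = ∃ λ x → toℕ x ≡ i × xs ≡ x ∷ ys
      tail-edges : ∀ {x} xs → All IsJust (pathColours G (x ∷ xs)) → All IsJust (pathColours G xs)
      tail-edges [] _ = []
      tail-edges (_ ∷ _) (_ ∷ js) = js
      classify : ∀ {xs} → RepeatingPath (suc m) xs → _ ⊎ _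
      classify (len , j ∷ _ , here {x} {y} {ys} c∈) =
        inj₁ (x , y , ys , refl , suc-injective len , ≤-trans (n≤1+n _) (≤-reflexive (suc-injective len)) , j , c∈)
      classify (len , js , there {x} {ys} r) =
        inj₂ (toℕ x , toℕ<n x , ys , (suc-injective len , tail-edges ys js , r) , x , refl , refl)
      arithmetic : ∀ m → m * n ^ m + n * (m * m * n ^ (m ∸ 1)) ≤ suc m * suc m * n ^ m
      arithmetic zero rewrite *-zeroʳ n = z≤n
      arithmetic (suc m) = ≤-trans (≤-reflexive (regroup (suc m) n (n ^ m))) (*-monoˡ-≤ (n * n ^ m) (square (suc m)))
        where
        regroup : ∀ a n e → a * (n * e) + n * (a * a * e) ≡ (a + a * a) * (n * e)
        regroup = solve-∀
        expand : ∀ a → suc a * suc a ≡ (a + a * a) + suc a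
        expand = solve-∀
        square : ∀ a → a + a * a ≤ suc a * suc a
        square a = subst (a + a * a ≤_) (sym (expand a)) (m≤m+n _ _)

    -- Two edges of equal colour leave two arcs with at least three edges altogether, so one arc has
    -- at least two. Rotation puts it first, which leaves room for `a` and `v` before the edge `dc`.
    closing-colour-repeats : ∀ {xs} → 5 ≤ length xs → ¬ Unique (closedColours G xs) →
      ∃ λ us → ∃ λ vs → xs ≡ us ++ vs ×
      ∃ λ as → ∃ λ c → ∃ λ bs → closedColours G (vs ++ us) ≡ as ++ c ∷ bs ++ c ∷ [] × 2 ≤ length as
    closing-colour-repeats {xs} 5≤ ¬u with unique-or-repeat (Maybe-≡-dec Data.Nat._≟_) (closedColours G xs)
    ... | inj₁ u = ⊥-elim (¬u u)
    ... | inj₂ (as , c , bs , ds , e) with 2 ≤? length bs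
    ... | yes 2≤ =
      let us , vs , e₁ , _ , e₂ = rotate-to xs (as ++ c ∷ []) (bs ++ c ∷ ds)
            (trans e (sym (++-assoc as (c ∷ []) _)))
      in us , vs , e₁ , bs , c , ds ++ as ,
         trans e₂ (trans (++-assoc bs (c ∷ ds) _) (cong (λ t → bs ++ c ∷ t) (sym (++-assoc ds as _)))) , 2≤
    ... | no 2≰ =
      let us , vs , e₁ , _ , e₂ = rotate-to xs (as ++ c ∷ bs ++ c ∷ []) ds
            (trans e (trans (cong (λ t → as ++ c ∷ t) (sym (++-assoc bs (c ∷ []) ds)))
              (sym (++-assoc as (c ∷ bs ++ c ∷ []) ds))))
      in us , vs , e₁ , ds ++ as , c , bs , trans e₂ (sym (++-assoc ds as _)) ,
         subst (2 ≤_) (sym (length-++ ds)) (+-cancelˡ-≤ 3 2 _ (≤-trans 5≤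
           (≤-trans (≤-reflexive total) (+-monoˡ-≤ (length ds + length as) (s≤s (s≤s (s≤s⁻¹ (≰⇒> 2≰))))))))
      where
      regroup : ∀ a b d → a + suc (b + suc d) ≡ suc (suc b) + (d + a)
      regroup = solve-∀
      total : length xs ≡ suc (suc (length bs)) + (length ds + length as)
      total = trans (sym (length-closedColours xs)) (trans (cong length e) (trans (length-++ as)
        (trans (cong (λ t → length as + suc t) (length-++ bs)) (regroup (length as) (length bs) (length ds)))))

    module _ (j b : ℕ) (rainbow-free : ¬ HasRainbowCycle G (2 * (2 + j + b) + 1)) where

      private
        m = 3 * (2 * (2 + j + b) + 1)
        E = n ^ (3 + 2 * j)

      RainbowList : List V → Set
      RainbowList xs = ∃ λ (q : Quad G proper j b rainbow-free) → RainbowCycle G proper j b rainbow-free q ×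
        (let x₁ , x₂ , x₃ , x₄ , r = q in xs ≡ x₁ ∷ x₂ ∷ x₃ ∷ x₄ ∷ r)

      RepeatList : ℕ → List V → Set
      RepeatList p xs = ∃ λ (q : Chain G proper j b rainbow-free) →
        RepeatCycle G proper j b rainbow-free p (suc (2 * j) ∸ p) q ×
        (let a , v , g , d , c , h = q in xs ≡ a ∷ v ∷ g ++ d ∷ c ∷ h)

      DoubleRepeatList : List V → Set
      DoubleRepeatList xs = ∃ λ a → ∃ λ v → ∃ λ ys → xs ≡ a ∷ v ∷ ys × RepeatingPath (4 + 2 * j) (v ∷ ys) ×
        length ys ≤ 4 + 2 * j × IsJust (col G a (last v ys)) × col G a (last v ys) ∈ pathColours G (v ∷ ys)

      NonRainbowList : List V → Set
      NonRainbowList xs = (∃ λ p → p < 2 + 2 * j × RepeatList p xs) ⊎ DoubleRepeatList xs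

      CycleList : List V → Set
      CycleList xs = Cycle G xs × length xs ≡ 5 + 2 * j

      -- The closing edge at `a` repeats a colour of the path that starts at `v`. If this path is
      -- rainbow, the cycle is a `RepeatCycle`; otherwise the path's own repetition saves a second
      -- power of `n`.
      nonRainbowList : ∀ {xs as c bs} → CycleList xs →
        closedColours G xs ≡ as ++ c ∷ bs ++ c ∷ [] → 2 ≤ length as → NonRainbowList xs
      nonRainbowList {xs} {_ ∷ []} _ _ (s≤s ())
      nonRainbowList {_ ∷ []} {_ ∷ _ ∷ _} (_ , ())
      nonRainbowList {a ∷ v ∷ ys} {_ ∷ a₂ ∷ as} {c} {bs} (cyc , len) e _
        with e₁ , e₂ ← ∷ʳ-injective (pathColours G (v ∷ ys)) (a₂ ∷ as ++ c ∷ bs)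
          (trans (sym (walkColours-last G v ys)) (trans (∷-injectiveʳ e) (sym (++-assoc (a₂ ∷ as) (c ∷ bs) _))))
        -- The colour `a₂` of the edge leaving `v` is skipped, so the edge is found inside `ys` and
        -- `d` comes after `v`.
        with edge-of-colour ys as (pathColours-tail ys e₁) | unique-or-repeating (v ∷ ys)
      ... | _ | inj₂ r = inj₂ (a , v , ys , refl ,
              (suc-injective len , proj₂ (cycle-tail G cyc) , r) ,
              ≤-trans (n≤1+n _) (≤-reflexive (suc-injective len)) ,
              subst IsJust (col-sym G _ _) (last-edge G cyc) ,
              subst (_∈ pathColours G (v ∷ ys)) (trans (sym e₂) (col-sym G _ _))
                (subst (c ∈_) (sym e₁) (∈-++⁺ʳ (a₂ ∷ as) (here refl))))
      ... | g , d , d' , h , refl , e₃ | inj₁ u = inj₁ (length g , p<  ,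
              (a , v , g , d , d' , h) ,
              (refl , q≡ , cyc , u , trans e₃ (trans (sym e₂) (cong (λ l → col G l a) (last-++ v g)))) , refl)
        where
        p+q : length g + length h ≡ suc (2 * j)
        p+q = +-cancelˡ-≡ 4 _ _ (trans (sym (trans (cong (2 +_) (length-++ g))
          (cong (2 +_) (trans (+-suc _ _) (cong suc (+-suc _ _)))))) len)
        p< : length g < 2 + 2 * j
        p< = s≤s (subst (length g ≤_) p+q (m≤m+n _ _))
        q≡ : length h ≡ suc (2 * j) ∸ length g
        q≡ = trans (sym (m+n∸m≡n (length g) (length h))) (cong (_∸ length g) p+q)

      -- Once the length `i` of the moved part is recorded, the rotated list gives back the
      -- original, so each non-rainbow list is charged at most `6 + 2 * j` times.
      Rotation : ℕ → List V → List V → Set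
      Rotation i xs ys = ∃ λ us → ∃ λ vs → length us ≡ i × xs ≡ us ++ vs × ys ≡ vs ++ us

      rotation-injective : ∀ {i xs xs' ys} → Rotation i xs ys → Rotation i xs' ys → xs ≡ xs'
      rotation-injective (us , vs , len , refl , refl) (us' , vs' , len' , refl , e)
        with refl , refl ← ++-injective vs vs' (+-cancelʳ-≡ (length us) _ _ (trans (sym (length-++ vs))
          (trans (cong length e) (trans (length-++ vs') (cong (length vs' +_) (trans len' (sym len))))))) e = refl

      classify : ∀ {xs} → CycleList xs →
        RainbowList xs ⊎ (∃ λ i → i < 6 + 2 * j × ∃ λ ys → NonRainbowList ys × Rotation i xs ys)
      classify {xs} (cyc , len) with unique-or-repeat (Maybe-≡-dec Data.Nat._≟_) (closedColours G xs)
      classify {x₁ ∷ x₂ ∷ x₃ ∷ x₄ ∷ r} (cyc , len) | inj₁ u =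
        inj₁ ((x₁ , x₂ , x₃ , x₄ , r) , (+-cancelˡ-≡ 4 _ _ len , cyc , u) , refl)
      classify {xs} (cyc , len) | inj₂ (as , c , bs , ds , e)
        with us , vs , refl , _ , _ , _ , e' , 2≤ ← closing-colour-repeats {xs}
          (subst (5 ≤_) (sym len) (m≤m+n 5 _)) (λ u → repeat⇒¬unique as (subst Unique e u)) =
        inj₂ (length us , s≤s (subst (length us ≤_) len (subst (length us ≤_) (sym (length-++ us)) (m≤m+n _ _))) ,
          vs ++ us ,
          nonRainbowList (cycle-rotate G us vs cyc ,
            trans (length-++ vs) (trans (+-comm (length vs) _) (trans (sym (length-++ us)) len))) e' 2≤ ,
          us , vs , refl , refl , refl)

      bounded-nonRainbowLists : Bounded NonRainbowList ((2 + 2 * j) * (m * (2 * E)) +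
        (4 + 2 * j) * ((4 + 2 * j) * (4 + 2 * j) * E))
      bounded-nonRainbowLists = bounded-⊎
        (bounded-∃ (2 + 2 * j) λ p p< → bounded-rel
          (λ xs (a , v , g , d , c , h) → xs ≡ a ∷ v ∷ g ++ d ∷ c ∷ h)
          (λ { refl refl → refl }) id
          (bounded-repeatCycles G proper j b rainbow-free p (suc (2 * j) ∸ p) (m+[n∸m]≡n (s≤s⁻¹ p<))))
        -- The repetition in the path has saved one vertex and the closing edge saves `a`, so the
        -- exponent is again `3 + 2 * j`.
        (bounded-determined last (4 + 2 * j) (bounded-repeatingPaths (4 + 2 * j)))

      bounded-cycleLists : Bounded CycleList (m * m * (4 * E) + (6 + 2 * j) *
        ((2 + 2 * j) * (m * (2 * E)) + (4 + 2 * j) * ((4 + 2 * j) * (4 + 2 * j) * E)))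
      bounded-cycleLists xs uxs all = bounded-⊎
        (bounded-rel (λ xs (x₁ , x₂ , x₃ , x₄ , r) → xs ≡ x₁ ∷ x₂ ∷ x₃ ∷ x₄ ∷ r)
          (λ { refl refl → refl }) id (bounded-rainbowCycles G proper j b rainbow-free))
        (bounded-∃ (6 + 2 * j) λ i _ → bounded-rel (Rotation i) rotation-injective id bounded-nonRainbowLists)
        xs uxs (All.map classify all)

-- The labelled cycles as a list

toList-injective : {A : Set} {m : ℕ} (v w : Vec A m) → toList v ≡ toList w → v ≡ w
toList-injective []ᵛ []ᵛ _ = refl
toList-injective (x ∷ᵛ v) (y ∷ᵛ w) e =
  cong₂ _∷ᵛ_ (∷-injectiveˡ e) (toList-injective v w (∷-injectiveʳ e))

∈-allVecs : ∀ {m n} (v : Vec (Fin n) m) → v ∈ allVecs m n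
∈-allVecs []ᵛ = here refl
∈-allVecs {suc m} {n} (x ∷ᵛ v) = ∈-concatMap⁺ (λ i → map (i ∷ᵛ_) (allVecs m n))
  (Any.map (λ { refl → ∈-map⁺ (x ∷ᵛ_) (∈-allVecs v) }) (∈-allFin x))

unique-allVecs : ∀ m n → Unique (allVecs m n)
unique-allVecs zero n = [] ∷ []
unique-allVecs (suc m) n = Unique.concat⁺
  (All-map⁺ (All.tabulate λ _ → Unique.map⁺ (λ { refl → refl }) (unique-allVecs m n)))
  (AllPairs-map⁺ (AllPairs.map disjoint (Unique.allFin⁺ n)))
  where
  disjoint : ∀ {i i'} → i ≢ i' → ∀ {v} → v ∈ map (i ∷ᵛ_) (allVecs m n) × v ∈ map (i' ∷ᵛ_) (allVecs m n) → ⊥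
  disjoint ne (p , q) with _ , _ , refl ← ∈-map⁻ (_ ∷ᵛ_) p | _ , _ , refl ← ∈-map⁻ (_ ∷ᵛ_) q = ne refl

cycleCopies≤labelledCycles : ∀ {n} (G : ColouredGraph n) m → cycleCopies G m ≤ labelledCycles G m
cycleCopies≤labelledCycles G zero = z≤n
cycleCopies≤labelledCycles G (suc m) = m/n≤m (labelledCycles G (suc m)) (2 * suc m)

labelledCycles-bounded : ∀ {n} (G : ColouredGraph n) m {M} →
  Bounded (λ xs → Cycle G xs × length xs ≡ m) M → labelledCycles G m ≤ M
labelledCycles-bounded {n} G m bounded = bounded-rel (λ v xs → toList v ≡ xs)
  (λ e e' → toList-injective _ _ (trans e (sym e')))
  (λ {v} is-cycle → toList v , (isCycle⁻ G v is-cycle , length-toList v) , refl) bounded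
  (filterᵇ (isCycleᵇ G) (allVecs m n)) (Unique.filter⁺ (T? ∘ isCycleᵇ G) (unique-allVecs m n))
  (All.tabulate λ v∈ → T⇒≡true (proj₂ (∈-filter⁻ (T? ∘ isCycleᵇ G) {xs = allVecs m n} v∈)))
  where
  T⇒≡true : ∀ {b} → T b → b ≡ true
  T⇒≡true {true} _ = refl

-- Upper bound for the number of copies

upperConstant : ℕ → ℕ → ℕ
upperConstant j b = m * m * 4 + (6 + 2 * j) * ((2 + 2 * j) * (m * 2) + (4 + 2 * j) * ((4 + 2 * j) * (4 + 2 * j)))
  where m = 3 * (2 * (2 + j + b) + 1)

cycleCopies-upper : ∀ j b {n} (G : ColouredGraph n) → Proper G → ¬ HasRainbowCycle G (2 * (2 + j + b) + 1) →
  cycleCopies G (2 * (2 + j) + 1) ≤ upperConstant j b * n ^ (2 * (2 + j) ∸ 1)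
cycleCopies-upper j b {n} G proper rainbow-free =
  ≤-trans (cycleCopies≤labelledCycles G (2 * (2 + j) + 1))
    (labelledCycles-bounded G (2 * (2 + j) + 1)
      λ xs uxs all → subst (length xs ≤_) total
        (bounded-cycleLists G proper j b rainbow-free xs uxs
          (All.map (λ { (cyc , len) → cyc , trans len (odd j) }) all)))
  where
  odd : ∀ j → 2 * (2 + j) + 1 ≡ 5 + 2 * j
  odd = solve-∀
  even : ∀ j → 2 * (2 + j) ≡ 4 + 2 * j
  even = solve-∀
  collect : ∀ m i p q e → m * m * (4 * e) + i * (p * (m * (2 * e)) + q * (q * q * e)) ≡
    (m * m * 4 + i * (p * (m * 2) + q * (q * q))) * e
  collect = solve-∀
  total = trans (collect (3 * (2 * (2 + j + b) + 1)) (6 + 2 * j) (2 + 2 * j) (4 + 2 * j) (n ^ (3 + 2 * j)))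
    (cong (λ e → upperConstant j b * n ^ (e ∸ 1)) (sym (even j)))

-- The extremal graph

unique-map-injective : {A B : Set} (f : A → B) {xs : List A} {x y : A} → Unique (map f xs) →
  x ∈ xs → y ∈ xs → f x ≡ f y → x ≡ y
unique-map-injective f _ (here refl) (here refl) _ = refl
unique-map-injective f (fx∉ ∷ _) (here refl) (there y∈) e = ⊥-elim (All.lookup fx∉ (∈-map⁺ f y∈) e)
unique-map-injective f (fy∉ ∷ _) (there x∈) (here refl) e = ⊥-elim (All.lookup fy∉ (∈-map⁺ f x∈) (sym e))
unique-map-injective f (_ ∷ u) (there x∈) (there y∈) e = unique-map-injective f u x∈ y∈ e

-- Otherwise `f` would change at every step, hence an odd number of times before returning to its
-- initial value.
odd-closed-walk : {n : ℕ} (f : Fin n → Bool) (k : ℕ) (xs : List (Fin n)) → length xs ≡ 2 * k + 1 →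
  ∃ λ p → p ∈ cyclePairs xs × f (proj₁ p) ≡ f (proj₂ p)
odd-closed-walk f k [] len = ⊥-elim (m+1+n≢0 (2 * k) (sym len))
odd-closed-walk {n} f k (x ∷ xs) len
  with any? (λ p → f (proj₁ p) ≟B f (proj₂ p)) (cyclePairs (x ∷ xs))
... | yes some = find some
... | no none = ⊥-elim (not-¬ refl (trans (alternate x xs (¬Any⇒All¬ _ none))
        (trans (cong (λ i → flips i (f x)) len) (flips-odd k (f x)))))
  where
  flips : ℕ → Bool → Bool
  flips zero b = b
  flips (suc i) b = flips i (not b)
  flips-odd : ∀ k b → flips (2 * k + 1) b ≡ not b
  flips-odd zero b = refl
  flips-odd (suc k) b rewrite +-suc k (k + 0) | not-involutive b = flips-odd k b
  alternate : ∀ u us {z} → All (λ p → f (proj₁ p) ≢ f (proj₂ p)) (zip (u ∷ us) (us ++ [ z ])) →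
    f z ≡ flips (suc (length us)) (f u)
  alternate u [] (ne ∷ []) = ¬-not (ne ∘ sym)
  alternate u (v ∷ us) (ne ∷ nes) = trans (alternate v us nes)
    (cong (λ b → flips (suc (length us)) b) (¬-not (ne ∘ sym)))

parity : ℕ → Bool
parity zero = false
parity (suc a) = not (parity a)

parity-even : ∀ j → parity (2 * j) ≡ false
parity-even zero = refl
parity-even (suc j) rewrite +-suc j (j + 0) | not-involutive (parity (2 * j)) = parity-even j

∨-true⁻ : ∀ a {b} → a ∨ b ≡ true → a ≡ true ⊎ b ≡ true
∨-true⁻ true _ = inj₁ refl
∨-true⁻ false e = inj₂ e

≡ᵇ-true⁻ : ∀ a b → (a ≡ᵇ b) ≡ true → a ≡ b
≡ᵇ-true⁻ a b e = ≡ᵇ⇒≡ a b (subst T (sym e) tt)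

≡ᵇ-refl : ∀ a → (a ≡ᵇ a) ≡ true
≡ᵇ-refl zero = refl
≡ᵇ-refl (suc a) = ≡ᵇ-refl a

≡ᵇ-comm : ∀ a b → (a ≡ᵇ b) ≡ (b ≡ᵇ a)
≡ᵇ-comm zero zero = refl
≡ᵇ-comm zero (suc b) = refl
≡ᵇ-comm (suc a) zero = refl
≡ᵇ-comm (suc a) (suc b) = ≡ᵇ-comm a b

matchStep : ℕ → ℕ → Bool
matchStep a b = ((a ≡ᵇ 0) ∧ (b ≡ᵇ 1)) ∨ ((a ≡ᵇ 2) ∧ (b ≡ᵇ 3))

matched : ℕ → ℕ → Bool
matched a b = matchStep a b ∨ matchStep b a

matchStep⁻ : ∀ a b → matchStep a b ≡ true → (a ≡ 0 × b ≡ 1) ⊎ (a ≡ 2 × b ≡ 3)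
matchStep⁻ a b e with ∨-true⁻ ((a ≡ᵇ 0) ∧ (b ≡ᵇ 1)) e
... | inj₁ e₁ = let p , q = ∧-true⁻ (a ≡ᵇ 0) e₁ in inj₁ (≡ᵇ-true⁻ a 0 p , ≡ᵇ-true⁻ b 1 q)
... | inj₂ e₂ = let p , q = ∧-true⁻ (a ≡ᵇ 2) e₂ in inj₂ (≡ᵇ-true⁻ a 2 p , ≡ᵇ-true⁻ b 3 q)

data Matched : ℕ → ℕ → Set where
  m01 : Matched 0 1
  m10 : Matched 1 0
  m23 : Matched 2 3
  m32 : Matched 3 2

matched⁻ : ∀ a b → matched a b ≡ true → Matched a b
matched⁻ a b e with ∨-true⁻ (matchStep a b) e
... | inj₁ e₁ with matchStep⁻ a b e₁
... | inj₁ (refl , refl) = m01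
... | inj₂ (refl , refl) = m23
matched⁻ a b e | inj₂ e₂ with matchStep⁻ b a e₂
... | inj₁ (refl , refl) = m10
... | inj₂ (refl , refl) = m32

matched-functional : ∀ {a b b'} → Matched a b → Matched a b' → b ≡ b'
matched-functional m01 m01 = refl
matched-functional m10 m10 = refl
matched-functional m23 m23 = refl
matched-functional m32 m32 = refl

matched-irrefl : ∀ a → matched a a ≡ false
matched-irrefl 0 = refl
matched-irrefl 1 = refl
matched-irrefl 2 = refl
matched-irrefl 3 = refl
matched-irrefl (suc (suc (suc (suc a)))) = refl

-- On the odd cycle of classes, `cut₀₁` alternates at every step but the one from 0 to 1, and
-- `cut₂₃` at every step but the one from 2 to 3. An odd cycle in the blow-up must therefore use
-- both of these pairs.
cut₀₁ : ℕ → Bool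
cut₀₁ zero = true
cut₀₁ (suc a) = parity (suc a)

cut₂₃ : ℕ → Bool
cut₂₃ 0 = false
cut₂₃ 1 = true
cut₂₃ 2 = false
cut₂₃ (suc (suc (suc a))) = parity a

module _ (j : ℕ) where

  private
    M = 5 + 2 * j

  adjacentStep : ℕ → ℕ → Bool
  adjacentStep a b = (b ≡ᵇ suc a) ∨ ((a ≡ᵇ 4 + 2 * j) ∧ (b ≡ᵇ 0))

  adjacent : ℕ → ℕ → Bool
  adjacent a b = adjacentStep a b ∨ adjacentStep b a

  adjacentStep⁻ : ∀ a b → adjacentStep a b ≡ true → b ≡ suc a ⊎ (a ≡ 4 + 2 * j × b ≡ 0)
  adjacentStep⁻ a b e with ∨-true⁻ (b ≡ᵇ suc a) e
  ... | inj₁ e₁ = inj₁ (≡ᵇ-true⁻ b (suc a) e₁)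
  ... | inj₂ e₂ = let p , q = ∧-true⁻ (a ≡ᵇ 4 + 2 * j) e₂ in inj₂ (≡ᵇ-true⁻ a (4 + 2 * j) p , ≡ᵇ-true⁻ b 0 q)

  adjacent-irrefl : ∀ a → adjacent a a ≡ false
  adjacent-irrefl a with adjacentStep a a in e
  ... | false = refl
  ... | true with adjacentStep⁻ a a e
  ... | inj₂ (p , q) = case trans (sym p) q of λ ()

  cut₀₁-step : ∀ a b → adjacentStep a b ≡ true → matched a b ≡ false → cut₀₁ a ≢ cut₀₁ b
  cut₀₁-step a b e ne eq with adjacentStep⁻ a b e
  cut₀₁-step zero _ e () eq | inj₁ refl
  cut₀₁-step (suc a) _ e ne eq | inj₁ refl = not-¬ refl eq
  cut₀₁-step _ _ e ne eq | inj₂ (refl , refl) rewrite parity-even j = case eq of λ ()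

  cut₂₃-step : ∀ a b → adjacentStep a b ≡ true → matched a b ≡ false → cut₂₃ a ≢ cut₂₃ b
  cut₂₃-step a b e ne eq with adjacentStep⁻ a b e
  cut₂₃-step 0 _ e ne () | inj₁ refl
  cut₂₃-step 1 _ e ne () | inj₁ refl
  cut₂₃-step 2 _ e () eq | inj₁ refl
  cut₂₃-step (suc (suc (suc a))) _ e ne eq | inj₁ refl = not-¬ refl eq
  cut₂₃-step _ _ e ne eq | inj₂ (refl , refl) rewrite parity-even j = case eq of λ ()

  matched-comm : ∀ a b → matched a b ≡ matched b a
  matched-comm a b = ∨-comm (matchStep a b) (matchStep b a)

  cut-adjacent : (f : ℕ → Bool) → (∀ a b → adjacentStep a b ≡ true → matched a b ≡ false → f a ≢ f b) →
    ∀ a b → adjacent a b ≡ true → matched a b ≡ false → f a ≢ f b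
  cut-adjacent f step a b e ne with ∨-true⁻ (adjacentStep a b) e
  ... | inj₁ e₁ = step a b e₁ ne
  ... | inj₂ e₂ = step b a e₂ (trans (matched-comm b a) ne) ∘ sym

  module _ (n : ℕ) where

    -- Division by `M` encodes a vertex as its class and its position there; the matchings will join
    -- equal positions.
    class index : Fin n → ℕ
    class v = toℕ v % M
    index v = toℕ v / M

    class-index-injective : ∀ {u v} → class u ≡ class v → index u ≡ index v → u ≡ v
    class-index-injective {u} {v} e e' = toℕ-injective (trans (m≡m%n+[m/n]*n (toℕ u) M)
      (trans (cong₂ (λ c i → c + i * M) e e') (sym (m≡m%n+[m/n]*n (toℕ v) M))))

    colour : Fin n → Fin n → Maybe ℕ
    colour u v =
      if matched (class u) (class v) then (if index u ≡ᵇ index v then just 0 else nothing)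
      else (if adjacent (class u) (class v) then just (suc (toℕ u + toℕ v)) else nothing)

    -- Colour 0 is reserved for the two matchings; on the other edges suc (u + v) is
    -- symmetric and determines v from u.
    blowUp : ColouredGraph n
    blowUp = record { col = colour ; sym = colour-sym ; irrefl = colour-irrefl }
      where
      colour-sym : ∀ u v → colour u v ≡ colour v u
      colour-sym u v rewrite ∨-comm (matchStep (class u) (class v)) (matchStep (class v) (class u))
        | ∨-comm (adjacentStep (class u) (class v)) (adjacentStep (class v) (class u))
        | ≡ᵇ-comm (index u) (index v) | +-comm (toℕ u) (toℕ v) = refl
      colour-irrefl : ∀ u → colour u u ≡ nothing
      colour-irrefl u rewrite matched-irrefl (class u) | adjacent-irrefl (class u) = refl

    colour⁻ : ∀ u v {c} → colour u v ≡ just c →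
      (Matched (class u) (class v) × index u ≡ index v × c ≡ 0) ⊎
      (adjacent (class u) (class v) ≡ true × matched (class u) (class v) ≡ false × c ≡ suc (toℕ u + toℕ v))
    colour⁻ u v e with matched (class u) (class v) in eq
    ... | true with index u ≡ᵇ index v in eq'
    ... | true = inj₁ (matched⁻ (class u) (class v) eq , ≡ᵇ-true⁻ _ _ eq' , sym (just-injective e))
    colour⁻ u v e | false with adjacent (class u) (class v) in eq'
    ... | true = inj₂ (refl , refl , sym (just-injective e))

    blowUp-proper : Proper blowUp
    blowUp-proper u v w c v≢w e e' with colour⁻ u v e | colour⁻ u w e'
    ... | inj₁ (m , i , _) | inj₁ (m' , i' , _) =
      v≢w (class-index-injective (matched-functional m m') (trans (sym i) i'))
    ... | inj₁ (_ , _ , refl) | inj₂ (_ , _ , ())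
    ... | inj₂ (_ , _ , refl) | inj₁ (_ , _ , ())
    ... | inj₂ (_ , _ , refl) | inj₂ (_ , _ , s) = v≢w (toℕ-injective (+-cancelˡ-≡ (toℕ u) _ _ (suc-injective s)))

    -- `f` changes along every unmatched edge, so an edge of the odd cycle on which it does not
    -- change lies in a matching and has colour 0.
    cut-edge : (f : ℕ → Bool) → (∀ a b → adjacentStep a b ≡ true → matched a b ≡ false → f a ≢ f b) →
      ∀ k xs → length xs ≡ 2 * k + 1 → All IsJust (closedColours blowUp xs) →
      ∃ λ u → ∃ λ v → (u , v) ∈ cyclePairs xs × f (class u) ≡ f (class v) ×
        Matched (class u) (class v) × colour u v ≡ just 0
    cut-edge f step k xs len js with (u , v) , uv∈ , eq ← odd-closed-walk (f ∘ class) k xs len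
      with c , e ← All.lookup js (subst (colour u v ∈_) (closedColours-cyclePairs blowUp xs) (∈-map⁺ _ uv∈))
      with colour⁻ u v e
    ... | inj₁ (m , _ , refl) = u , v , uv∈ , eq , m , e
    ... | inj₂ (a , ne , _) = ⊥-elim (cut-adjacent f step _ _ a ne eq)

    -- Each cut yields an edge of colour 0. In a rainbow cycle these would be the same edge, but no
    -- matched pair of classes is left undivided by both cuts.
    blowUp-rainbow-free : ∀ k → ¬ HasRainbowCycle blowUp (2 * k + 1)
    blowUp-rainbow-free k (vs , is-cycle , uc)
      with cyc ← isCycle⁻ blowUp vs is-cycle
      with cut-edge cut₀₁ cut₀₁-step k (toList vs) (length-toList vs) (proj₂ cyc)
         | cut-edge cut₂₃ cut₂₃-step k (toList vs) (length-toList vs) (proj₂ cyc)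
    ... | u , v , uv∈ , eq , m , e | u' , v' , uv'∈ , eq' , _ , e'
      with refl ← unique-map-injective (λ p → colour (proj₁ p) (proj₂ p)) {x = u , v} {y = u' , v'}
        (subst Unique (sym (closedColours-cyclePairs blowUp (toList vs)))
          (subst Unique (map-just-cycleColours blowUp vs cyc) (Unique.map⁺ just-injective uc)))
        uv∈ uv'∈ (trans e (sym e'))
      = both-cuts m eq eq'
      where
      both-cuts : ∀ {a b} → Matched a b → cut₀₁ a ≡ cut₀₁ b → cut₂₃ a ≢ cut₂₃ b
      both-cuts m01 _ ()
      both-cuts m10 _ ()
      both-cuts m23 () _
      both-cuts m32 () _

-- Counting cycles in the extremal graph

length-allVecs : ∀ m n → length (allVecs m n) ≡ n ^ m
length-allVecs zero n = refl
length-allVecs (suc m) n = trans (extend-all (allFin n))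
  (cong₂ _*_ (length-tabulate {n = n} id) (length-allVecs m n))
  where
  extend-all : ∀ (is : List (Fin n)) →
    length (concatMap (λ i → map (i ∷ᵛ_) (allVecs m n)) is) ≡ length is * length (allVecs m n)
  extend-all [] = refl
  extend-all (i ∷ is) = trans (length-++ (map (i ∷ᵛ_) (allVecs m n)))
    (cong₂ _+_ (length-map (i ∷ᵛ_) (allVecs m n)) (extend-all is))

module _ (j n q : ℕ) .{{_ : NonZero n}} (room : q * (5 + 2 * j) ≤ n) where

  private
    M = 5 + 2 * j

  -- The reduction modulo `n` only lands the value in `Fin n`; by `room` it changes nothing when
  -- `a < M`.
  vertex : ℕ → Fin q → Fin n
  vertex a i = (a + toℕ i * M) mod n

  toℕ-vertex : ∀ {a} i → a < M → toℕ (vertex a i) ≡ a + toℕ i * M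
  toℕ-vertex {a} i a<M = trans (toℕ-fromℕ< _) (m<n⇒m%n≡m (≤-trans (+-monoˡ-≤ (toℕ i * M) a<M)
    (≤-trans (*-monoˡ-≤ M (toℕ<n i)) room)))

  class-vertex : ∀ {a} i → a < M → class j n (vertex a i) ≡ a
  class-vertex {a} i a<M = trans (cong (_% M) (toℕ-vertex i a<M))
    (trans ([m+kn]%n≡m%n a (toℕ i) M) (m<n⇒m%n≡m a<M))

  index-vertex : ∀ {a} i → a < M → index j n (vertex a i) ≡ toℕ i
  index-vertex {a} i a<M = *-cancelʳ-≡ _ _ M (+-cancelˡ-≡ a _ _ (sym
    (trans (sym (toℕ-vertex i a<M)) (trans (m≡m%n+[m/n]*n (toℕ (vertex a i)) M)
      (cong (_+ index j n (vertex a i) * M) (class-vertex i a<M))))))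

  vertex-injective : ∀ {a i i'} → a < M → vertex a i ≡ vertex a i' → i ≡ i'
  vertex-injective {i = i} {i'} a<M e = toℕ-injective
    (trans (sym (index-vertex i a<M)) (trans (cong (index j n) e) (index-vertex i' a<M)))

  adjacent-edge : ∀ {a b} i i' → a < M → b < M → matched a b ≡ false → adjacent j a b ≡ true →
    IsJust (colour j n (vertex a i) (vertex b i'))
  adjacent-edge i i' a<M b<M ne e
    rewrite class-vertex i a<M | class-vertex i' b<M | ne | e = _ , refl

  matched-edge : ∀ {a b} i → a < M → b < M → matched a b ≡ true →
    IsJust (colour j n (vertex a i) (vertex b i))
  matched-edge i a<M b<M e
    rewrite class-vertex i a<M | class-vertex i b<M | e
          | index-vertex i a<M | index-vertex i b<M | ≡ᵇ-refl (toℕ i) = _ , refl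

  vertices : ∀ {m} → ℕ → Vec (Fin q) m → List (Fin n)
  vertices a []ᵛ = []
  vertices a (i ∷ᵛ is) = vertex a i ∷ vertices (suc a) is

  length-vertices : ∀ {m} a (is : Vec (Fin q) m) → length (vertices a is) ≡ m
  length-vertices a []ᵛ = refl
  length-vertices a (i ∷ᵛ is) = cong suc (length-vertices (suc a) is)

  vertices-injective : ∀ {m} a (is is' : Vec (Fin q) m) → a + m ≤ M → vertices a is ≡ vertices a is' → is ≡ is'
  vertices-injective a []ᵛ []ᵛ _ _ = refl
  vertices-injective {suc m} a (i ∷ᵛ is) (i' ∷ᵛ is') le e = let le' = subst (_≤ M) (+-suc a m) le in
    cong₂ _∷ᵛ_ (vertex-injective (≤-trans (s≤s (m≤m+n a m)) le') (∷-injectiveˡ e))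
      (vertices-injective (suc a) is is' le' (∷-injectiveʳ e))

  vertices-class : ∀ {m} a (is : Vec (Fin q) m) → a + m ≤ M → All (λ v → a ≤ class j n v) (vertices a is)
  vertices-class a []ᵛ _ = []
  vertices-class {suc m} a (i ∷ᵛ is) le = let le' = subst (_≤ M) (+-suc a m) le in
    ≤-reflexive (sym (class-vertex i (≤-trans (s≤s (m≤m+n a m)) le'))) ∷
    All.map (≤-trans (n≤1+n a)) (vertices-class (suc a) is le')

  fresh-class : ∀ {a v} → class j n v ≡ a → ∀ {vs} → All (λ w → suc a ≤ class j n w) vs → All (v ≢_) vs
  fresh-class e = All.map λ { lt refl → <-irrefl (sym e) lt }

  vertices-unique : ∀ {m} a (is : Vec (Fin q) m) → a + m ≤ M → Unique (vertices a is)
  vertices-unique a []ᵛ _ = []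
  vertices-unique {suc m} a (i ∷ᵛ is) le = let le' = subst (_≤ M) (+-suc a m) le in
    fresh-class (class-vertex i (≤-trans (s≤s (m≤m+n a m)) le')) (vertices-class (suc a) is le') ∷
    vertices-unique (suc a) is le'

  -- From class 3 onwards, back round to class 0, no consecutive classes are matched, so the
  -- positions can be chosen freely.
  closing-walk : ∀ {m} a i i₀ (is : Vec (Fin q) m) → m + a ≡ suc (2 * j) →
    All IsJust (walkColours (blowUp j n) (vertex (3 + a) i) (vertices (4 + a) is) (vertex 0 i₀))
  closing-walk _ i i₀ []ᵛ refl = adjacent-edge i i₀ ≤-refl (s≤s z≤n) refl wrap ∷ []
    where
    wrap : adjacent j (4 + 2 * j) 0 ≡ true
    wrap rewrite ≡ᵇ-refl (2 * j) = refl
  closing-walk {suc m} a i i₀ (i' ∷ᵛ is) e =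
    adjacent-edge i i' (≤-trans (n≤1+n _) a<M) a<M refl next ∷ closing-walk (suc a) i' i₀ is (trans (+-suc m a) e)
    where
    next : adjacent j (3 + a) (4 + a) ≡ true
    next rewrite ≡ᵇ-refl a = refl
    a<M : 4 + a < M
    a<M = +-monoʳ-≤ 4 (subst (suc a ≤_) e (s≤s (m≤n+m a m)))

  -- The matchings force equal positions in classes 0 and 1 and in classes 2 and 3, which leaves
  -- `3 + 2 * j` free choices for `5 + 2 * j` vertices.
  transversal : Vec (Fin q) (3 + 2 * j) → List (Fin n)
  transversal (i₀ ∷ᵛ i₁ ∷ᵛ is) = vertices 0 (i₀ ∷ᵛ i₀ ∷ᵛ i₁ ∷ᵛ i₁ ∷ᵛ is)

  transversal-cycle : ∀ w → Cycle (blowUp j n) (transversal w)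
  transversal-cycle (i₀ ∷ᵛ i₁ ∷ᵛ is) =
    vertices-unique 0 (i₀ ∷ᵛ i₀ ∷ᵛ i₁ ∷ᵛ i₁ ∷ᵛ is) ≤-refl ,
    matched-edge i₀ (s≤s z≤n) (s≤s (s≤s z≤n)) refl ∷
    adjacent-edge i₀ i₁ (s≤s (s≤s z≤n)) (s≤s (s≤s (s≤s z≤n))) refl refl ∷
    matched-edge i₁ (s≤s (s≤s (s≤s z≤n))) (s≤s (s≤s (s≤s (s≤s z≤n)))) refl ∷
    closing-walk 0 i₁ i₀ is (+-identityʳ _)

  transversal-injective : ∀ w w' → transversal w ≡ transversal w' → w ≡ w'
  transversal-injective (i₀ ∷ᵛ i₁ ∷ᵛ is) (i₀' ∷ᵛ i₁' ∷ᵛ is') e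
    with refl ← vertices-injective 0 (i₀ ∷ᵛ i₀ ∷ᵛ i₁ ∷ᵛ i₁ ∷ᵛ is) (i₀' ∷ᵛ i₀' ∷ᵛ i₁' ∷ᵛ i₁' ∷ᵛ is') ≤-refl e = refl

  length-transversal : ∀ w → length (transversal w) ≡ M
  length-transversal (i₀ ∷ᵛ i₁ ∷ᵛ is) = length-vertices 0 (i₀ ∷ᵛ i₀ ∷ᵛ i₁ ∷ᵛ i₁ ∷ᵛ is)

  labelledCycles-lower : q ^ (3 + 2 * j) ≤ labelledCycles (blowUp j n) M
  labelledCycles-lower = subst (_≤ labelledCycles (blowUp j n) M) (length-allVecs (3 + 2 * j) q)
    (bounded-rel {P = λ _ → ⊤} (λ w vs → toList vs ≡ transversal w)
      (λ {w} {w'} e e' → transversal-injective w w' (trans (sym e) e'))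
      (λ {w} _ → let vs , e = word (transversal w) (length-transversal w) in
        vs , ∈-filter⁺ (T? ∘ isCycleᵇ (blowUp j n)) (∈-allVecs vs)
          (subst T (sym (isCycle⁺ (blowUp j n) vs (subst (Cycle (blowUp j n)) (sym e) (transversal-cycle w)))) tt) , e)
      (bounded-∈ (filterᵇ (isCycleᵇ (blowUp j n)) (allVecs M n)))
      (allVecs (3 + 2 * j) q) (unique-allVecs (3 + 2 * j) q) (All.tabulate λ _ → tt))

-- The quotient is at least 1, so the remainder is at most `d * (n / d)`: rounding down loses at
-- most a factor 2.
n≤[d+d]*[n/d] : ∀ n d .{{_ : NonZero d}} → d ≤ n → n ≤ (d + d) * (n / d)
n≤[d+d]*[n/d] n d d≤n = ≤-trans (≤-reflexive (m≡m%n+[m/n]*n n d))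
  (≤-trans (+-mono-≤ (≤-trans (<⇒≤ (m%n<n n d)) (m≤m*n d (n / d) {{>-nonZero (m≥n⇒m/n>0 d≤n)}}))
      (≤-reflexive (*-comm (n / d) d)))
    (≤-reflexive (sym (*-distribʳ-+ (n / d) d d))))

^-distribʳ-* : ∀ e a b → (a * b) ^ e ≡ a ^ e * b ^ e
^-distribʳ-* zero a b = refl
^-distribʳ-* (suc e) a b = trans (cong (a * b *_) (^-distribʳ-* e a b)) (interchange a b (a ^ e) (b ^ e))
  where
  interchange : ∀ a b c d → a * b * (c * d) ≡ a * c * (b * d)
  interchange = solve-∀

-- The first factor pays for the rounding in `n / M`, the second for dividing by the `2 * M`
-- labellings of a copy.
lowerConstant : ℕ → ℕ
lowerConstant j = (M + M) ^ (3 + 2 * j) * (2 * M + 2 * M)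
  where M = 5 + 2 * j

-- Makes `n / M` at least `2 * M`, so that there are at least `2 * M` labelled cycles and the
-- division by `2 * M` does not round to 0.
threshold : ℕ → ℕ
threshold j = 2 * M * M
  where M = 5 + 2 * j

cycleCopies-lower : ∀ j n → threshold j ≤ n →
  n ^ (3 + 2 * j) ≤ lowerConstant j * cycleCopies (blowUp j n) (5 + 2 * j)
cycleCopies-lower j n@(suc _) large = begin
  n ^ e                       ≤⟨ ^-monoˡ-≤ e (n≤[d+d]*[n/d] n M M≤n) ⟩
  ((M + M) * q) ^ e           ≡⟨ ^-distribʳ-* e (M + M) q ⟩
  (M + M) ^ e * q ^ e         ≤⟨ *-monoʳ-≤ ((M + M) ^ e) (labelledCycles-lower j n q (m/n*n≤m n M)) ⟩
  (M + M) ^ e * L             ≤⟨ *-monoʳ-≤ ((M + M) ^ e) (n≤[d+d]*[n/d] L (2 * M) 2M≤L) ⟩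
  (M + M) ^ e * ((2 * M + 2 * M) * (L / (2 * M))) ≡⟨ *-assoc ((M + M) ^ e) _ _ ⟨
  lowerConstant j * (L / (2 * M)) ∎
  where
  open ≤-Reasoning
  M = 5 + 2 * j
  e = 3 + 2 * j
  q = n / M
  L = labelledCycles (blowUp j n) M
  2M≤q : 2 * M ≤ q
  2M≤q = subst (_≤ q) (m*n/n≡m (2 * M) M) (/-monoˡ-≤ M large)
  M≤n : M ≤ n
  M≤n = ≤-trans (m≤n*m M (2 * M)) large
  2M≤L : 2 * M ≤ L
  2M≤L = ≤-trans 2M≤q (≤-trans (m≤m*n q (q ^ (2 + 2 * j)) {{m^n≢0 q (2 + 2 * j) {{>-nonZero (≤-trans (s≤s z≤n) 2M≤q)}}}})
    (labelledCycles-lower j n q (m/n*n≤m n M)))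

theorem3p1 : (k l : ℕ) → 2 ≤ l → l ≤ k →
    Σ ℕ λ C → Σ ℕ λ D → Σ ℕ λ n₀ → (n : ℕ) → n₀ ≤ n →
    ((G : ColouredGraph n) → Proper G → ¬ HasRainbowCycle G (2 * k + 1) →
    cycleCopies G (2 * l + 1) ≤ C * n ^ (2 * l ∸ 1))
    × (Σ (ColouredGraph n) λ G → Proper G × ¬ HasRainbowCycle G (2 * k + 1) ×
    (n ^ (2 * l ∸ 1) ≤ D * cycleCopies G (2 * l + 1)))
theorem3p1 k l 2≤l l≤k with j , refl ← m≤n⇒∃[o]m+o≡n 2≤l with b , refl ← m≤n⇒∃[o]m+o≡n l≤k =
  upperConstant j b , lowerConstant j , threshold j , λ n large →
    cycleCopies-upper j b ,
    -- The graph depends only on `l` and `n`: it has no rainbow odd cycle of any length, so it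
    -- serves every `k`.
    blowUp j n , blowUp-proper j n , blowUp-rainbow-free j n k ,
    subst₂ (λ e m → n ^ e ≤ lowerConstant j * cycleCopies (blowUp j n) m)
      (cong (_∸ 1) (sym (even j))) (sym (odd j)) (cycleCopies-lower j n large)
  where
  odd : ∀ j → 2 * (2 + j) + 1 ≡ 5 + 2 * j
  odd = solve-∀
  even : ∀ j → 2 * (2 + j) ≡ 4 + 2 * j
  even = solve-∀
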